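{- Let $G$ be a finite simple bipartite graph of order $2n$ with $n\geq 2$. Then $f(G)=n-2$ if and only if $G$ belongs to $\mathcal{G}_1$ or to $\mathcal{G}_2$.
   Context: For a graph $G$ with a perfect matching $M$, a subset $S\subseteq M$ is a forcing set of $M$ if $S$ is contained in no perfect matching of $G$ other than $M$; $f(G,M)$ is the minimum size of a forcing set of $M$, and $f(G)=\min_M f(G,M)$ over perfect matchings $M$ (so $f(G)=n-2$ presupposes that $G$ has a perfect matching). $\mathcal{G}_1$ is the set of graphs obtained from $K_{n,n}$ with parts $U,V$ ($|U|=|V|=n$) by deleting all edges of $t\geq 1$ pairwise vertex-disjoint complete bipartite subgraphs with parts $A_i\subseteq U$, $B_i\subseteq V$, $A_i,B_i\neq\emptyset$, each of order $|A_i|+|B_i|\leq n$ (so the result is not $K_{n,n}$). $\mathcal{G}_2$ is the set of bipartite graphs of order $2n$ whose vertex set is the disjoint union of the vertex sets of two complete bipartite graphs $K_{a,a}$ and $K_{b,b}$ ($a,b\ge1$, $a+b=n$), containing both as subgraphs, such that every other edge of $G$ joins these two subgraphs and is forbidden, i.e. lies in no perfect matching of $G$. -}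

module Defs where

open import Data.Nat using (ℕ; _+_; _*_; _≤_)
open import Data.Bool using (Bool; true; false)
open import Data.Fin using (Fin)
open import Data.Fin.Subset using (Subset; _∈_; _∉_; ∣_∣; ∁; _∩_; Nonempty; _⊆_)
open import Data.Product using (Σ; _×_; ∃; ∃-syntax)
open import Data.Sum using (_⊎_)
open import Relation.Nullary using (¬_)
open import Relation.Binary.PropositionalEquality using (_≡_; _≢_)
open import Function.Bundles using (_⇔_)

record Graph (m : ℕ) : Set where
  field
    Adj    : Fin m → Fin m → Bool
    sym    : ∀ u v → Adj u v ≡ Adj v u
    irrefl : ∀ v → Adj v v ≡ false
open Graph public

Edge : ∀ {m} → Graph m → Fin m → Fin m → Set
Edge G u v = Adj G u v ≡ true

Bipartite : ∀ {m} → Graph m → Set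
Bipartite {m} G = Σ (Fin m → Bool) λ c → ∀ u v → Edge G u v → c u ≢ c v

-- A perfect matching, encoded by its partner function: μ v is the vertex
-- matched with v.  Edge set of the matching = { {v , μ v} }.
record PerfectMatching {m : ℕ} (G : Graph m) : Set where
  field
    μ       : Fin m → Fin m
    invol   : ∀ v → μ (μ v) ≡ v
    noFix   : ∀ v → μ v ≢ v
    inGraph : ∀ v → Edge G v (μ v)
open PerfectMatching public

-- A subset S of the edges of M is encoded by the set of vertices covered
-- by those edges (closed under μ M); it has ∣ S ∣ / 2 edges.
-- S is a forcing set of M: every perfect matching containing all the
-- edges of S equals M.
IsForcingSet : ∀ {m} {G : Graph m} → PerfectMatching G → Subset m → Set
IsForcingSet {m} {G} M S =
  (∀ v → v ∈ S → μ M v ∈ S) ×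
  ((N : PerfectMatching G) → (∀ v → v ∈ S → μ N v ≡ μ M v) → ∀ v → μ N v ≡ μ M v)

ForcingNumberIs : ∀ {m} → Graph m → ℕ → Set
ForcingNumberIs {m} G k =
  (Σ (PerfectMatching G) λ M → Σ (Subset m) λ S → IsForcingSet M S × ∣ S ∣ ≡ 2 * k) ×
  ((M : PerfectMatching G) (S : Subset m) → IsForcingSet M S → 2 * k ≤ ∣ S ∣)

Across : ∀ {m} → Subset m → Fin m → Fin m → Set
Across V u v = (u ∈ V × v ∉ V) ⊎ (u ∉ V × v ∈ V)

Forbidden : ∀ {m} → Graph m → Fin m → Fin m → Set
Forbidden G u v = (N : PerfectMatching G) → μ N u ≢ v

-- 𝒢₁ : G is (a labelled copy of) K_{n,n} with parts U = ∁ V, V, minus all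
-- edges of t ≥ 1 pairwise vertex-disjoint complete bipartite subgraphs with
-- nonempty parts A i ⊆ U, B i ⊆ V and |A i| + |B i| ≤ n.
InG1 : (n : ℕ) → Graph (n + n) → Set
InG1 n G =
  Σ (Subset (n + n)) λ V →
  ∣ V ∣ ≡ n × ∣ ∁ V ∣ ≡ n ×
  Σ ℕ λ t → 1 ≤ t ×
  Σ (Fin t → Subset (n + n)) λ A →
  Σ (Fin t → Subset (n + n)) λ B →
    (∀ i → A i ⊆ ∁ V) × (∀ i → B i ⊆ V) ×
    (∀ i → Nonempty (A i)) × (∀ i → Nonempty (B i)) ×
    (∀ i → ∣ A i ∣ + ∣ B i ∣ ≤ n) ×
    (∀ i j → i ≢ j → ∀ x → x ∈ A i → x ∉ A j) ×
    (∀ i j → i ≢ j → ∀ x → x ∈ B i → x ∉ B j) ×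
    (∀ u v → Edge G u v ⇔
       (Across V u v ×
        ¬ (∃[ i ] ((u ∈ A i × v ∈ B i) ⊎ (v ∈ A i × u ∈ B i)))))

-- 𝒢₂ : the vertex set is X ⊎ ∁ X, where X spans a K_{a,a} and ∁ X a K_{b,b}
-- (sides given by V), a , b ≥ 1, a + b = n; G contains both as subgraphs,
-- every other edge joins X and ∁ X, and all such edges are forbidden.
InG2 : (n : ℕ) → Graph (n + n) → Set
InG2 n G =
  Σ ℕ λ a → Σ ℕ λ b → 1 ≤ a × 1 ≤ b × a + b ≡ n ×
  Σ (Subset (n + n)) λ X → Σ (Subset (n + n)) λ V →
    ∣ X ∩ ∁ V ∣ ≡ a × ∣ X ∩ V ∣ ≡ a ×
    ∣ ∁ X ∩ ∁ V ∣ ≡ b × ∣ ∁ X ∩ V ∣ ≡ b ×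
    (∀ u v → u ∈ X → v ∈ X → Across V u v → Edge G u v) ×
    (∀ u v → u ∉ X → v ∉ X → Across V u v → Edge G u v) ×
    (∀ u v → Edge G u v → u ∈ X → v ∈ X → Across V u v) ×
    (∀ u v → Edge G u v → u ∉ X → v ∉ X → Across V u v) ×
    (∀ u v → Edge G u v → u ∈ X → v ∉ X → Forbidden G u v)

{-# OPTIONS --safe #-}
module Submission where

-- Fix a matching M and contract its edges, so that the remaining edges of G become arcs of a
-- digraph; matchings other than M correspond to disjoint directed cycles.  A set of M-edges whose
-- complement can be ordered without forward arcs is forcing, so f(G) ≥ n − 2 says that any three
-- M-edges span a directed cycle, for every M, and f(G) ≤ n − 2 says that some arc is missing.
-- If f(G) = n − 2 and the bipartite complement of G contains an induced path u₁v₁u₂v₂, then a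
-- matching through u₁v₂ would contain three edges spanning no cycle; so u₁v₂ is an arc on no
-- cycle, and the condition on triples makes the edges split into two complete halves: G ∈ 𝒢₂.
-- If there is no such path, the complement is a disjoint union of complete bipartite graphs
-- and isolated vertices: G ∈ 𝒢₁.

open import Defs renaming (sym to adj-sym)
open import Data.Bool using (Bool; true; false; not; if_then_else_)
import Data.Bool.Properties as Bool
open import Data.Empty using (⊥; ⊥-elim)
open import Data.Fin using (Fin; zero; suc; _≟_)
open import Data.Fin.Permutation.Components using (transpose; transpose-inverse)
open import Data.Fin.Properties using (any?)
open import Data.Fin.Subset
  using (Subset; inside; outside; _∈_; _∉_; ∣_∣; ∁; _∩_; _∪_; _-_; Nonempty; _⊆_; ⊤)
open import Data.Fin.Subset.Properties
open import Data.List using (List; []; _∷_; length; map; filter; deduplicate; allFin; lookup)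
import Data.List.Membership.DecPropositional as DecMembership
open import Data.List.Membership.Propositional using () renaming (_∈_ to _∈ˡ_; _∉_ to _∉ˡ_)
open import Data.List.Membership.Propositional.Properties
  using (∈-map⁺; ∈-map⁻; ∈-filter⁺; ∈-filter⁻; ∈-deduplicate⁺; ∈-deduplicate⁻; ∈-allFin; ∈-lookup)
open import Data.List.Relation.Unary.All as All using (All; []; _∷_)
open import Data.List.Relation.Unary.AllPairs as AllPairs using (AllPairs; []; _∷_)
open import Data.List.Relation.Unary.Any as Any using (here; there)
open import Data.List.Relation.Unary.Any.Properties using (lookup-index)
open import Data.List.Relation.Unary.Unique.DecPropositional.Properties using (deduplicate-!)
open import Data.Nat using (ℕ; zero; suc; _+_; _*_; _∸_; _≤_; _<_; z≤n; s≤s)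
open import Data.Nat.Properties hiding (_≟_)
open import Data.Product using (Σ; _×_; _,_; proj₁; proj₂; ∃-syntax)
open import Data.Sum using (_⊎_; inj₁; inj₂; [_,_]′)
open import Data.Vec as Vec using ([]; _∷_; here; there; tabulate)
open import Data.Vec.Properties using (lookup⇒[]=; []=⇒lookup; lookup∘tabulate; ≡-dec)
open import Function using (_∘_; case_of_)
open import Function.Bundles using (_⇔_; mk⇔; Equivalence)
open import Relation.Binary.Definitions using (DecidableEquality)
open import Relation.Binary.PropositionalEquality
  using (_≡_; _≢_; refl; sym; trans; cong; subst; ≢-sym)
open import Relation.Nullary using (¬_; Dec; yes; no; does; contradiction)
open import Relation.Nullary.Decidable using (dec-true; dec-false; ¬?; _×-dec_; decidable-stable)
open import Relation.Unary using (Decidable)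

-- Cardinalities of finite subsets

private
  variable
    k m n : ℕ

⟦_⟧ : {P : Fin m → Set} → Decidable P → Subset m
⟦ P? ⟧ = tabulate (does ∘ P?)

∈-⟦⟧⁺ : {P : Fin m → Set} (P? : Decidable P) {x : Fin m} → P x → x ∈ ⟦ P? ⟧
∈-⟦⟧⁺ P? {x} px =
  lookup⇒[]= x _ (trans (lookup∘tabulate (does ∘ P?) x) (dec-true (P? x) px))

∈-⟦⟧⁻ : {P : Fin m → Set} (P? : Decidable P) {x : Fin m} → x ∈ ⟦ P? ⟧ → P x
∈-⟦⟧⁻ P? {x} x∈ with P? x | trans (sym (lookup∘tabulate (does ∘ P?) x)) ([]=⇒lookup x∈)
... | yes px | _  = px
... | no  _  | ()

x∉p-x : (p : Subset m) (x : Fin m) → x ∉ p - x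
x∉p-x (inside  ∷ p) zero    ()
x∉p-x (outside ∷ p) zero    ()
x∉p-x (s       ∷ p) (suc x) (there x∈) = x∉p-x p x x∈

∈-remove⁻ : (p : Subset m) {x y : Fin m} → x ∈ p - y → x ∈ p × x ≢ y
∈-remove⁻ p {x} {y} x∈ = p─q⊆p p _ x∈ , λ { refl → x∉p-x p x x∈ }

∣p∣≡1+∣p-x∣ : {p : Subset m} {x : Fin m} → x ∈ p → ∣ p ∣ ≡ suc ∣ p - x ∣
∣p∣≡1+∣p-x∣ {p = inside  ∷ p} here       = cong (suc ∘ ∣_∣) (sym (p─⊥≡p p))
∣p∣≡1+∣p-x∣ {p = inside  ∷ p} (there x∈) = cong suc (∣p∣≡1+∣p-x∣ x∈)
∣p∣≡1+∣p-x∣ {p = outside ∷ p} (there x∈) = ∣p∣≡1+∣p-x∣ x∈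

x∈p⇒1≤∣p∣ : {p : Subset m} {x : Fin m} → x ∈ p → 1 ≤ ∣ p ∣
x∈p⇒1≤∣p∣ x∈p = ≤-trans (s≤s z≤n) (≤-reflexive (sym (∣p∣≡1+∣p-x∣ x∈p)))

1≤∣p∣⇒Nonempty : (p : Subset m) → 1 ≤ ∣ p ∣ → Nonempty p
1≤∣p∣⇒Nonempty {m} p 1≤p with nonempty? p
... | yes x∈p  = x∈p
... | no empty = contradiction 1≤p (<⇒≱ (s≤s (≤-reflexive
                   (trans (cong ∣_∣ (Empty-unique empty)) (∣⊥∣≡0 m)))))

pick : (p : Subset m) → suc k ≤ ∣ p ∣ → ∃[ x ] (x ∈ p × k ≤ ∣ p - x ∣)
pick p k<p with 1≤∣p∣⇒Nonempty p (≤-trans (s≤s z≤n) k<p)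
... | x , x∈p = x , x∈p , ≤-pred (≤-trans k<p (≤-reflexive (∣p∣≡1+∣p-x∣ x∈p)))

pick₂ : (p : Subset m) → 2 ≤ ∣ p ∣ → ∃[ x ] ∃[ y ] (x ∈ p × y ∈ p × x ≢ y)
pick₂ p 2≤ =
  let x , x∈ , 1≤ = pick p 2≤
      y , y∈     = 1≤∣p∣⇒Nonempty (p - x) 1≤
      y∈p , y≢x  = ∈-remove⁻ p y∈
  in x , y , x∈ , y∈p , ≢-sym y≢x

pick₃ : (p : Subset m) → 3 ≤ ∣ p ∣ →
  ∃[ x ] ∃[ y ] ∃[ z ] (x ∈ p × y ∈ p × z ∈ p × x ≢ y × x ≢ z × y ≢ z)
pick₃ p 3≤ =
  let x , x∈ , 2≤ = pick p 3≤
      y , z , y∈ , z∈ , y≢z = pick₂ (p - x) 2≤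
      y∈p , y≢x  = ∈-remove⁻ p y∈
      z∈p , z≢x  = ∈-remove⁻ p z∈
  in x , y , z , x∈ , y∈p , z∈p , ≢-sym y≢x , ≢-sym z≢x , y≢z

∣p∪q∣≤∣p∣+∣q∣ : (p q : Subset m) → ∣ p ∪ q ∣ ≤ ∣ p ∣ + ∣ q ∣
∣p∪q∣≤∣p∣+∣q∣ []            []            = z≤n
∣p∪q∣≤∣p∣+∣q∣ (inside  ∷ p) (outside ∷ q) = s≤s (∣p∪q∣≤∣p∣+∣q∣ p q)
∣p∪q∣≤∣p∣+∣q∣ (inside  ∷ p) (inside  ∷ q) =
  s≤s (≤-trans (∣p∪q∣≤∣p∣+∣q∣ p q) (+-monoʳ-≤ ∣ p ∣ (n≤1+n ∣ q ∣)))
∣p∪q∣≤∣p∣+∣q∣ (outside ∷ p) (outside ∷ q) = ∣p∪q∣≤∣p∣+∣q∣ p q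
∣p∪q∣≤∣p∣+∣q∣ (outside ∷ p) (inside  ∷ q) =
  ≤-trans (s≤s (∣p∪q∣≤∣p∣+∣q∣ p q)) (≤-reflexive (sym (+-suc ∣ p ∣ ∣ q ∣)))

∣p∩q∣+∣∁p∩q∣≡∣q∣ : (p q : Subset m) → ∣ p ∩ q ∣ + ∣ ∁ p ∩ q ∣ ≡ ∣ q ∣
∣p∩q∣+∣∁p∩q∣≡∣q∣ []            []            = refl
∣p∩q∣+∣∁p∩q∣≡∣q∣ (inside  ∷ p) (inside  ∷ q) = cong suc (∣p∩q∣+∣∁p∩q∣≡∣q∣ p q)
∣p∩q∣+∣∁p∩q∣≡∣q∣ (inside  ∷ p) (outside ∷ q) = ∣p∩q∣+∣∁p∩q∣≡∣q∣ p q
∣p∩q∣+∣∁p∩q∣≡∣q∣ (outside ∷ p) (inside  ∷ q) =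
  trans (+-suc ∣ p ∩ q ∣ ∣ ∁ p ∩ q ∣) (cong suc (∣p∩q∣+∣∁p∩q∣≡∣q∣ p q))
∣p∩q∣+∣∁p∩q∣≡∣q∣ (outside ∷ p) (outside ∷ q) = ∣p∩q∣+∣∁p∩q∣≡∣q∣ p q

∣p∣+∣∁p∣≡n : (p : Subset m) → ∣ p ∣ + ∣ ∁ p ∣ ≡ m
∣p∣+∣∁p∣≡n p = trans (cong (∣ p ∣ +_) (∣∁p∣≡n∸∣p∣ p)) (m+[n∸m]≡n (∣p∣≤n p))

injection⇒∣p∣≤∣q∣ : (f : Fin m → Fin n) (p : Subset m) (q : Subset n) →
  (∀ {x} → x ∈ p → f x ∈ q) → (∀ {x y} → f x ≡ f y → x ≡ y) → ∣ p ∣ ≤ ∣ q ∣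
injection⇒∣p∣≤∣q∣ f p q f∈ inj = go ∣ p ∣ p q f∈ refl
  where
  go : ∀ k p q → (∀ {x} → x ∈ p → f x ∈ q) → ∣ p ∣ ≡ k → ∣ p ∣ ≤ ∣ q ∣
  go zero    p q f∈ eq = ≤-trans (≤-reflexive eq) z≤n
  go (suc k) p q f∈ eq with 1≤∣p∣⇒Nonempty p (≤-trans (s≤s z≤n) (≤-reflexive (sym eq)))
  ... | x , x∈p = ≤-trans (≤-reflexive (∣p∣≡1+∣p-x∣ x∈p))
                  (≤-trans (s≤s rest) (≤-reflexive (sym (∣p∣≡1+∣p-x∣ (f∈ x∈p)))))
    where
    rest : ∣ p - x ∣ ≤ ∣ q - f x ∣
    rest = go k (p - x) (q - f x)
      (λ z∈ → let z∈p , z≢x = ∈-remove⁻ p z∈ in x∈p∧x≢y⇒x∈p-y (f∈ z∈p) (z≢x ∘ inj))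
      (suc-injective (trans (sym (∣p∣≡1+∣p-x∣ x∈p)) eq))

injection-missing⇒∣p∣<∣q∣ : (f : Fin m → Fin n) (p : Subset m) (q : Subset n) →
  (∀ {x} → x ∈ p → f x ∈ q) → (∀ {x y} → f x ≡ f y → x ≡ y) →
  ∀ {y} → y ∈ q → (∀ {x} → x ∈ p → f x ≢ y) → ∣ p ∣ < ∣ q ∣
injection-missing⇒∣p∣<∣q∣ f p q f∈ inj {y} y∈q miss =
  ≤-trans (s≤s (injection⇒∣p∣≤∣q∣ f p (q - y) (λ x∈ → x∈p∧x≢y⇒x∈p-y (f∈ x∈) (miss x∈)) inj))
          (≤-reflexive (sym (∣p∣≡1+∣p-x∣ y∈q)))

involution-injective : (f : Fin m → Fin m) → (∀ x → f (f x) ≡ x) → ∀ {x y} → f x ≡ f y → x ≡ y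
involution-injective f invol {x} {y} eq = trans (sym (invol x)) (trans (cong f eq) (invol y))

-- Transpositions

transpose-left : (i j : Fin m) → transpose i j i ≡ j
transpose-left i j rewrite dec-true (i ≟ i) refl = refl

transpose-right : (i j : Fin m) → transpose i j j ≡ i
transpose-right i j with j ≟ i
... | yes j≡i = j≡i
... | no  _ rewrite dec-true (j ≟ j) refl = refl

transpose-fix : (i j : Fin m) {x : Fin m} → x ≢ i → x ≢ j → transpose i j x ≡ x
transpose-fix i j {x} x≢i x≢j rewrite dec-false (x ≟ i) x≢i | dec-false (x ≟ j) x≢j = refl

transpose-invariant : {A : Set} (f : Fin m → A) {i j : Fin m} → f i ≡ f j →
  ∀ x → f (transpose i j x) ≡ f x
transpose-invariant f {i} {j} eq x with x ≟ i
... | yes refl = sym eq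
... | no  _ with x ≟ j
...   | yes refl = eq
...   | no  _    = refl

-- A bijection between `p` and `q` stored as one involution of the whole vertex set, so that it can
-- serve directly as a partner function.
record Exchange (p q : Subset m) : Set where
  field
    to     : Fin m → Fin m
    to∈    : ∀ {x} → x ∈ p → to x ∈ q
    from∈  : ∀ {x} → x ∈ q → to x ∈ p
    invol′ : ∀ x → to (to x) ≡ x
    fixed  : ∀ {x} → x ∉ p → x ∉ q → to x ≡ x

exchange : (p q : Subset m) → ∣ p ∣ ≡ ∣ q ∣ → (∀ {x} → x ∈ p → x ∉ q) → Exchange p q
exchange {m} p q eq disj = go ∣ p ∣ p q refl (sym eq) disj
  where
  go : ∀ k (p q : Subset m) → ∣ p ∣ ≡ k → ∣ q ∣ ≡ k → (∀ {x} → x ∈ p → x ∉ q) → Exchange p q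
  go zero p q p≡0 q≡0 disj = record
    { to     = λ x → x
    ; to∈    = λ x∈p → contradiction (trans (sym (∣p∣≡1+∣p-x∣ x∈p)) p≡0) λ ()
    ; from∈  = λ x∈q → contradiction (trans (sym (∣p∣≡1+∣p-x∣ x∈q)) q≡0) λ ()
    ; invol′ = λ _ → refl
    ; fixed  = λ _ _ → refl
    }
  -- Pair off one point `a` of `p` with one point `b` of `q`; the recursive involution fixes both,
  -- so it composes with their transposition.
  go (suc k) p q p≡ q≡ disj
    with a , a∈p ← 1≤∣p∣⇒Nonempty p (≤-trans (s≤s z≤n) (≤-reflexive (sym p≡)))
       | b , b∈q ← 1≤∣p∣⇒Nonempty q (≤-trans (s≤s z≤n) (≤-reflexive (sym q≡)))
    = record
    { to     = f
    ; to∈    = to∈′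
    ; from∈  = from∈′
    ; invol′ = invol-f
    ; fixed  = λ x∉p x∉q →
        trans (f-other (λ { refl → x∉p a∈p }) (λ { refl → x∉q b∈q }))
              (E.fixed (x∉p ∘ proj₁ ∘ ∈-remove⁻ p {y = a}) (x∉q ∘ proj₁ ∘ ∈-remove⁻ q {y = b}))
    }
    where
    rest : Exchange (p - a) (q - b)
    rest = go k (p - a) (q - b)
      (suc-injective (trans (sym (∣p∣≡1+∣p-x∣ a∈p)) p≡))
      (suc-injective (trans (sym (∣p∣≡1+∣p-x∣ b∈q)) q≡))
      (λ x∈p x∈q → disj (proj₁ (∈-remove⁻ p {y = a} x∈p)) (proj₁ (∈-remove⁻ q {y = b} x∈q)))
    module E = Exchange rest
    f : Fin _ → Fin _
    f = E.to ∘ transpose a b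
    fix-a : E.to a ≡ a
    fix-a = E.fixed (x∉p-x p a) (disj a∈p ∘ proj₁ ∘ ∈-remove⁻ q {y = b})
    fix-b : E.to b ≡ b
    fix-b = E.fixed (λ b∈p → disj (proj₁ (∈-remove⁻ p {y = a} b∈p)) b∈q) (x∉p-x q b)
    f-a : f a ≡ b
    f-a = trans (cong E.to (transpose-left a b)) fix-b
    f-b : f b ≡ a
    f-b = trans (cong E.to (transpose-right a b)) fix-a
    f-other : ∀ {x} → x ≢ a → x ≢ b → f x ≡ E.to x
    f-other x≢a x≢b = cong E.to (transpose-fix a b x≢a x≢b)
    to∈′ : ∀ {x} → x ∈ p → f x ∈ q
    to∈′ {x} x∈p = case x ≟ a of λ where
      (yes refl) → subst (_∈ q) (sym f-a) b∈q
      (no x≢a)   → subst (_∈ q) (sym (f-other x≢a (λ { refl → disj x∈p b∈q })))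
                     (proj₁ (∈-remove⁻ q {y = b} (E.to∈ (x∈p∧x≢y⇒x∈p-y x∈p x≢a))))
    from∈′ : ∀ {x} → x ∈ q → f x ∈ p
    from∈′ {x} x∈q = case x ≟ b of λ where
      (yes refl) → subst (_∈ p) (sym f-b) a∈p
      (no x≢b)   → subst (_∈ p) (sym (f-other (λ { refl → disj a∈p x∈q }) x≢b))
                     (proj₁ (∈-remove⁻ p {y = a} (E.from∈ (x∈p∧x≢y⇒x∈p-y x∈q x≢b))))
    invol-f : ∀ x → f (f x) ≡ x
    invol-f x = by-cases (x ≟ a) (x ≟ b)
      where
      by-cases : Dec (x ≡ a) → Dec (x ≡ b) → f (f x) ≡ x
      by-cases (yes refl) _          = trans (cong f f-a) f-b
      by-cases (no _)     (yes refl) = trans (cong f f-b) f-a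
      by-cases (no x≢a)   (no x≢b)   =
        trans (cong f (f-other x≢a x≢b))
        (trans (f-other (λ e → x≢a (trans (sym (E.invol′ x)) (trans (cong E.to e) fix-a)))
                        (λ e → x≢b (trans (sym (E.invol′ x)) (trans (cong E.to e) fix-b))))
               (E.invol′ x))

-- Pairings of the two colour classes

true≢false : {b : Bool} → b ≡ true → b ≢ false
true≢false refl ()

-- A perfect matching of the complete bipartite graph between the colour classes. Membership of its
-- edges in `G` is left out, so that intermediate stages of a rotation or a repair may leave `G`.
record Pairing (c : Fin m → Bool) : Set where
  field
    π     : Fin m → Fin m
    π-π   : ∀ v → π (π v) ≡ v
    flips : ∀ v → c (π v) ≡ not (c v)

  π-injective : ∀ {x y} → π x ≡ π y → x ≡ y
  π-injective = involution-injective π π-π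

  π-true : ∀ {v} → c v ≡ false → c (π v) ≡ true
  π-true {v} cv = trans (flips v) (cong not cv)

  π-false : ∀ {v} → c v ≡ true → c (π v) ≡ false
  π-false {v} cv = trans (flips v) (cong not cv)

-- Conjugation by the transposition of `a` and `b` makes these two left vertices trade partners and
-- keeps the pairing an involution.
module Swap {c : Fin m → Bool} (P : Pairing c) {a b : Fin m}
            (ca : c a ≡ false) (cb : c b ≡ false) where
  open Pairing P

  private
    ca≡cb : c a ≡ c b
    ca≡cb = trans ca (sym cb)

  swap : Pairing c
  swap = record
    { π     = transpose a b ∘ π ∘ transpose b a
    ; π-π   = λ v → trans (cong (transpose a b ∘ π) (transpose-inverse b a))
                    (trans (cong (transpose a b) (π-π _)) (transpose-inverse a b))
    ; flips = λ v → trans (transpose-invariant c ca≡cb (π (transpose b a v)))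
                    (trans (flips (transpose b a v))
                           (cong not (transpose-invariant c (sym ca≡cb) v)))
    }

  private
    π-fixed : ∀ {v} → c v ≡ false → transpose a b (π v) ≡ π v
    π-fixed cv = transpose-fix a b (λ e → true≢false (π-true cv) (trans (cong c e) ca))
                                   (λ e → true≢false (π-true cv) (trans (cong c e) cb))

  swap-left : Pairing.π swap a ≡ π b
  swap-left = trans (cong (transpose a b ∘ π) (transpose-right b a)) (π-fixed cb)

  swap-right : Pairing.π swap b ≡ π a
  swap-right = trans (cong (transpose a b ∘ π) (transpose-left b a)) (π-fixed ca)

  swap-other : ∀ {v} → c v ≡ false → v ≢ a → v ≢ b → Pairing.π swap v ≡ π v
  swap-other cv v≢a v≢b =
    trans (cong (transpose a b ∘ π) (transpose-fix b a v≢b v≢a)) (π-fixed cv)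

-- Matchings of a 2-coloured graph

module Coloured {m : ℕ} (G : Graph m) (c : Fin m → Bool)
                (proper : ∀ u v → Edge G u v → c u ≢ c v) where

  edge? : ∀ u v → Dec (Edge G u v)
  edge? u v = Adj G u v Bool.≟ true

  edge-sym : ∀ {u v} → Edge G u v → Edge G v u
  edge-sym {u} {v} e = trans (adj-sym G v u) e

  Left : Fin m → Set
  Left v = c v ≡ false

  toPairing : PerfectMatching G → Pairing c
  toPairing M = record
    { π     = μ M
    ; π-π   = invol M
    ; flips = λ v → Bool.¬-not (proper _ _ (inGraph M v) ∘ sym)
    }

  -- Every pair has a left end, so checking the edges at left vertices covers all of them.
  fromPairing : (P : Pairing c) → (∀ {u} → Left u → Edge G u (Pairing.π P u)) → PerfectMatching G
  fromPairing P edge = record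
    { μ       = π
    ; invol   = π-π
    ; noFix   = λ v e → Bool.not-¬ (cong c e) (flips v)
    ; inGraph = λ v → in-G v (c v) refl
    }
    where
    open Pairing P
    in-G : ∀ v b → c v ≡ b → Edge G v (π v)
    in-G v false cv = edge cv
    in-G v true  cv = edge-sym (subst (Edge G (π v)) (π-π v) (edge (π-false cv)))

  module Matching (M : PerfectMatching G) where
    open Pairing (toPairing M) public using (π-injective; π-true; π-false)

    -- Orienting the edges of G from Left and contracting M yields a digraph on Left
    -- whose directed cycles are the M-alternating cycles.
    Arc : Fin m → Fin m → Set
    Arc x y = Edge G x (μ M y)

    arc? : ∀ x y → Dec (Arc x y)
    arc? x y = edge? x (μ M y)

  open Matching using (Arc; arc?; π-injective; π-true; π-false)

  -- Switching a matching along short directed cycles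

  module _ (M : PerfectMatching G) where

    -- For `x ≢ y` the two arcs close an `M`-alternating 4-cycle, and `N` is `M` switched along it.
    rotate₂ : ∀ {x y} → Left x → Left y → Arc M x y → Arc M y x →
      Σ (PerfectMatching G) λ N → μ N x ≡ μ M y ×
        (∀ {v} → Left v → v ≢ x → v ≢ y → μ N v ≡ μ M v)
    rotate₂ {x} {y} cx cy xy yx =
      fromPairing swap edge , swap-left , swap-other
      where
      open Swap (toPairing M) cx cy
      edge : ∀ {u} → Left u → Edge G u (Pairing.π swap u)
      edge {u} cu = case (u ≟ x) of λ where
        (yes refl) → subst (Edge G u) (sym swap-left) xy
        (no u≢x) → case (u ≟ y) of λ where
          (yes refl) → subst (Edge G u) (sym swap-right) yx
          (no u≢y) → subst (Edge G u) (sym (swap-other cu u≢x u≢y)) (inGraph M u)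

    -- Two swaps switch an `M`-alternating 6-cycle: the first gives `x` its new partner and hands
    -- `μ M x` to `y`, the second passes it on to `z`. The pairing in between need not lie in `G`.
    rotate₃ : ∀ {x y z} → Left x → Left y → Left z → x ≢ y → x ≢ z → y ≢ z →
      Arc M x y → Arc M y z → Arc M z x →
      Σ (PerfectMatching G) λ N → μ N x ≡ μ M y ×
        (∀ {v} → Left v → v ≢ x → v ≢ y → v ≢ z → μ N v ≡ μ M v)
    rotate₃ {x} {y} {z} cx cy cz x≢y x≢z y≢z xy yz zx =
      fromPairing S₂.swap edge , at-x , at-other
      where
      module S₁ = Swap (toPairing M) cx cy
      module S₂ = Swap S₁.swap cy cz
      ρ = Pairing.π S₂.swap
      at-x : ρ x ≡ μ M y
      at-x = trans (S₂.swap-other cx x≢y x≢z) S₁.swap-left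
      at-y : ρ y ≡ μ M z
      at-y = trans S₂.swap-left (S₁.swap-other cz (≢-sym x≢z) (≢-sym y≢z))
      at-z : ρ z ≡ μ M x
      at-z = trans S₂.swap-right S₁.swap-right
      at-other : ∀ {v} → Left v → v ≢ x → v ≢ y → v ≢ z → ρ v ≡ μ M v
      at-other cv v≢x v≢y v≢z = trans (S₂.swap-other cv v≢y v≢z) (S₁.swap-other cv v≢x v≢y)
      edge : ∀ {u} → Left u → Edge G u (ρ u)
      edge {u} cu = case (u ≟ x) of λ where
        (yes refl) → subst (Edge G u) (sym at-x) xy
        (no u≢x) → case (u ≟ y) of λ where
          (yes refl) → subst (Edge G u) (sym at-y) yz
          (no u≢y) → case (u ≟ z) of λ where
            (yes refl) → subst (Edge G u) (sym at-z) zx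
            (no u≢z) → subst (Edge G u) (sym (at-other cu u≢x u≢y u≢z)) (inGraph M u)

    -- Three swaps, in the same manner. Only the new partner of `x` is recorded, because the purpose
    -- is to exhibit a matching through one given edge.
    rotate₄ : ∀ {x y z w} → Left x → Left y → Left z → Left w →
      x ≢ y → x ≢ z → x ≢ w → y ≢ z → y ≢ w → z ≢ w →
      Arc M x y → Arc M y z → Arc M z w → Arc M w x →
      Σ (PerfectMatching G) λ N → μ N x ≡ μ M y
    rotate₄ {x} {y} {z} {w} cx cy cz cw x≢y x≢z x≢w y≢z y≢w z≢w xy yz zw wx =
      fromPairing S₃.swap edge , at-x
      where
      module S₁ = Swap (toPairing M) cx cy
      module S₂ = Swap S₁.swap cy cz
      module S₃ = Swap S₂.swap cz cw
      ρ = Pairing.π S₃.swap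
      at-x : ρ x ≡ μ M y
      at-x = trans (S₃.swap-other cx x≢z x≢w) (trans (S₂.swap-other cx x≢y x≢z) S₁.swap-left)
      at-y : ρ y ≡ μ M z
      at-y = trans (S₃.swap-other cy y≢z y≢w)
             (trans S₂.swap-left (S₁.swap-other cz (≢-sym x≢z) (≢-sym y≢z)))
      at-z : ρ z ≡ μ M w
      at-z = trans S₃.swap-left
             (trans (S₂.swap-other cw (≢-sym y≢w) (≢-sym z≢w))
                    (S₁.swap-other cw (≢-sym x≢w) (≢-sym y≢w)))
      at-w : ρ w ≡ μ M x
      at-w = trans S₃.swap-right (trans S₂.swap-right S₁.swap-right)
      edge : ∀ {u} → Left u → Edge G u (ρ u)
      edge {u} cu = case (u ≟ x) of λ where
        (yes refl) → subst (Edge G u) (sym at-x) xy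
        (no u≢x) → case (u ≟ y) of λ where
          (yes refl) → subst (Edge G u) (sym at-y) yz
          (no u≢y) → case (u ≟ z) of λ where
            (yes refl) → subst (Edge G u) (sym at-z) zw
            (no u≢z) → case (u ≟ w) of λ where
              (yes refl) → subst (Edge G u) (sym at-w) wx
              (no u≢w) → subst (Edge G u)
                (sym (trans (S₃.swap-other cu u≢z u≢w)
                     (trans (S₂.swap-other cu u≢y u≢z) (S₁.swap-other cu u≢x u≢y))))
                (inGraph M u)

  -- Forcing sets from triangular lists

  module _ (M : PerfectMatching G) where
    open DecMembership (_≟_ {m}) using () renaming (_∈?_ to _∈ˡ?_)

    agree-partner : (N : PerfectMatching G) → ∀ {v} → μ N v ≡ μ M v → μ N (μ M v) ≡ μ M (μ M v)
    agree-partner N {v} e = trans (cong (μ N) (sym e)) (trans (invol N v) (sym (invol M v)))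

    agree-from-Left : (N : PerfectMatching G) (S : Subset m) →
      (∀ {v} → v ∈ S → μ M v ∈ S) → (∀ {v} → v ∈ S → Left v → μ N v ≡ μ M v) →
      ∀ v → v ∈ S → μ N v ≡ μ M v
    agree-from-Left N S closed agree v v∈S with c v in cv
    ... | false = agree v∈S cv
    ... | true  = subst (λ x → μ N x ≡ μ M x) (invol M v)
                    (agree-partner N (agree (closed v∈S) (π-false M cv)))

    -- The first vertex of a triangular list has no arc to the later ones, so any matching
    -- that agrees with M off the list must agree with M at that vertex as well.
    triangular⇒agree : (T : List (Fin m)) → All Left T → AllPairs (λ x y → ¬ Arc M x y) T →
      (N : PerfectMatching G) → (∀ {v} → v ∉ˡ T → μ M v ∉ˡ T → μ N v ≡ μ M v) →
      ∀ v → μ N v ≡ μ M v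
    triangular⇒agree []      _         _            N agree v = agree (λ ()) (λ ())
    triangular⇒agree (a ∷ T) (ca ∷ cT) (¬aT ∷ tri) N agree =
      triangular⇒agree T cT tri N agree′
      where
      -- `y` is the left end of the `M`-edge at `μ N a`, so `N` uses the arc from `a` to `y`. If `y`
      -- is in `T`, that arc is missing; if it is outside `a ∷ T`, then `N` also gives `y` the
      -- partner `μ N a`, which forces `y` to be `a`.
      y = μ M (μ N a)
      μy : μ M y ≡ μ N a
      μy = invol M _
      cNa : c (μ N a) ≡ true
      cNa = π-true N ca
      Left-list : ∀ {v} → v ∈ˡ a ∷ T → Left v
      Left-list = All.lookup (ca ∷ cT)
      at-a : μ N a ≡ μ M a
      at-a = case (y ≟ a) of λ where
        (yes y≡a) → trans (sym μy) (cong (μ M) y≡a)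
        (no y≢a) → case (y ∈ˡ? T) of λ where
          (yes y∈T) → contradiction (subst (Edge G a) (sym μy) (inGraph N a)) (All.lookup ¬aT y∈T)
          (no y∉T) → contradiction
            (π-injective N (trans (agree (λ { (here e) → y≢a e ; (there y∈T) → y∉T y∈T })
              (λ μy∈ → true≢false (trans (cong c μy) cNa) (Left-list μy∈))) μy)) y≢a
      agree′ : ∀ {v} → v ∉ˡ T → μ M v ∉ˡ T → μ N v ≡ μ M v
      agree′ {v} v∉T μv∉T = case (v ≟ a) of λ where
        (yes refl) → at-a
        (no v≢a) → case (μ M v ≟ a) of λ where
          (yes μv≡a) → subst (λ x → μ N x ≡ μ M x) (trans (cong (μ M) (sym μv≡a)) (invol M v))
                         (agree-partner N at-a)
          (no μv≢a) → agree (λ { (here e) → v≢a e ; (there v∈T) → v∉T v∈T })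
                            (λ { (here e) → μv≢a e ; (there μv∈T) → μv∉T μv∈T })

    -- The vertices of the `M`-edges that avoid `T`; this turns a list of uncovered edges into a
    -- candidate forcing set.
    offEdges : List (Fin m) → Subset m
    offEdges []      = ⊤
    offEdges (a ∷ T) = offEdges T - a - μ M a

    ∈-offEdges⁺ : ∀ T {v} → v ∉ˡ T → μ M v ∉ˡ T → v ∈ offEdges T
    ∈-offEdges⁺ []      _   _    = ∈⊤
    ∈-offEdges⁺ (a ∷ T) {v} v∉T μv∉T =
      x∈p∧x≢y⇒x∈p-y (x∈p∧x≢y⇒x∈p-y (∈-offEdges⁺ T (v∉T ∘ there) (μv∉T ∘ there)) (v∉T ∘ here))
        (λ e → μv∉T (here (trans (cong (μ M) e) (invol M a))))

    ∈-offEdges⁻ : ∀ T {v} → v ∈ offEdges T → v ∉ˡ T × μ M v ∉ˡ T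
    ∈-offEdges⁻ []      _  = (λ ()) , (λ ())
    ∈-offEdges⁻ (a ∷ T) {v} v∈ =
      let v∈′ , v≢μa = ∈-remove⁻ (offEdges T - a) {y = μ M a} v∈
          v∈″ , v≢a = ∈-remove⁻ (offEdges T) {y = a} v∈′
          v∉T , μv∉T = ∈-offEdges⁻ T v∈″
      in (λ { (here e) → v≢a e ; (there v∈T) → v∉T v∈T }) ,
         (λ { (here e) → v≢μa (trans (sym (invol M v)) (cong (μ M) e))
            ; (there μv∈T) → μv∉T μv∈T })

    ∣offEdges∣ : ∀ T → All Left T → AllPairs _≢_ T → ∣ offEdges T ∣ + 2 * length T ≡ m
    ∣offEdges∣ []      _         _            = trans (+-identityʳ _) (∣⊤∣≡n m)
    ∣offEdges∣ (a ∷ T) (ca ∷ cT) (a≢ ∷ uniq) =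
      trans (cong (∣ offEdges T - a - μ M a ∣ +_) (*-suc 2 (length T)))
      (trans (sym (+-assoc ∣ offEdges T - a - μ M a ∣ 2 (2 * length T)))
      (trans (cong (_+ 2 * length T) (trans (+-comm _ 2) (sym size)))
             (∣offEdges∣ T cT uniq)))
      where
      a∉T : a ∉ˡ T
      a∉T a∈T = All.lookup a≢ a∈T refl
      μa∉T : μ M a ∉ˡ T
      μa∉T μa∈T = true≢false (π-true M ca) (All.lookup cT μa∈T)
      a∈ : a ∈ offEdges T
      a∈ = ∈-offEdges⁺ T a∉T μa∉T
      μa∈ : μ M a ∈ offEdges T - a
      μa∈ = x∈p∧x≢y⇒x∈p-y
        (∈-offEdges⁺ T μa∉T (a∉T ∘ subst (_∈ˡ T) (invol M a))) (noFix M a)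
      size : ∣ offEdges T ∣ ≡ 2 + ∣ offEdges T - a - μ M a ∣
      size = trans (∣p∣≡1+∣p-x∣ a∈) (cong suc (∣p∣≡1+∣p-x∣ μa∈))

    triangular⇒forcing : (T : List (Fin m)) → All Left T → AllPairs (λ x y → ¬ Arc M x y) T →
      IsForcingSet M (offEdges T) × ∣ offEdges T ∣ + 2 * length T ≡ m
    triangular⇒forcing T cT tri =
      (closed , λ N agree → triangular⇒agree T cT tri N
        (λ v∉ μv∉ → agree _ (∈-offEdges⁺ T v∉ μv∉))) ,
      -- The entries are distinct because each vertex has an arc to itself, namely its matching
      -- edge.
      ∣offEdges∣ T cT (AllPairs.map (λ {x} ¬arc → λ { refl → ¬arc (inGraph M x) }) tri)
      where
      closed : ∀ v → v ∈ offEdges T → μ M v ∈ offEdges T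
      closed v v∈ = let v∉T , μv∉T = ∈-offEdges⁻ T v∈
                    in ∈-offEdges⁺ T μv∉T (v∉T ∘ subst (_∈ˡ T) (invol M v))

  -- Edges left uncovered by a forcing set

  leftSet : Subset m
  leftSet = ⟦ (λ v → c v Bool.≟ false) ⟧

  ∈-leftSet⁺ : ∀ {v} → Left v → v ∈ leftSet
  ∈-leftSet⁺ = ∈-⟦⟧⁺ (λ v → c v Bool.≟ false)

  ∈-leftSet⁻ : ∀ {v} → v ∈ leftSet → Left v
  ∈-leftSet⁻ = ∈-⟦⟧⁻ (λ v → c v Bool.≟ false)

  module _ (M : PerfectMatching G) (S : Subset m) (forcing : IsForcingSet M S) where

    private
      closed = proj₁ forcing

      unmoved : (N : PerfectMatching G) →
        (∀ {v} → v ∈ S → Left v → μ N v ≡ μ M v) → ∀ v → μ N v ≡ μ M v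
      unmoved N agree = proj₂ forcing N (agree-from-Left M N S (closed _) agree)

      ≢-outside : ∀ {x v} → x ∉ S → v ∈ S → v ≢ x
      ≢-outside x∉S v∈S refl = x∉S v∈S

    -- Switching along a cycle outside `S` would give a second matching that agrees with `M` on `S`.
    forcing⇒no-2-cycle : ∀ {x y} → x ∉ S → y ∉ S → Left x → Left y → x ≢ y →
      Arc M x y → ¬ Arc M y x
    forcing⇒no-2-cycle x∉ y∉ cx cy x≢y xy yx =
      let N , at-x , at-other = rotate₂ M cx cy xy yx
      in x≢y (π-injective M (trans (sym (unmoved N (λ v∈ cv →
           at-other cv (≢-outside x∉ v∈) (≢-outside y∉ v∈)) _)) at-x))

    forcing⇒no-3-cycle : ∀ {x y z} → x ∉ S → y ∉ S → z ∉ S → Left x → Left y → Left z →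
      x ≢ y → x ≢ z → y ≢ z → Arc M x y → Arc M y z → ¬ Arc M z x
    forcing⇒no-3-cycle x∉ y∉ z∉ cx cy cz x≢y x≢z y≢z xy yz zx =
      let N , at-x , at-other = rotate₃ M cx cy cz x≢y x≢z y≢z xy yz zx
      in x≢y (π-injective M (trans (sym (unmoved N (λ v∈ cv →
           at-other cv (≢-outside x∉ v∈) (≢-outside y∉ v∈) (≢-outside z∉ v∈)) _)) at-x))

    outer : Subset m
    outer = ∁ S ∩ leftSet

    ∈-outer⁻ : ∀ {v} → v ∈ outer → v ∉ S × Left v
    ∈-outer⁻ v∈ = let v∈∁S , v∈L = x∈p∩q⁻ (∁ S) leftSet v∈ in x∈∁p⇒x∉p v∈∁S , ∈-leftSet⁻ v∈L

    -- `μ M` maps the uncovered right vertices injectively into `outer`, so at most `2 * ∣ outer ∣`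
    -- vertices lie outside `S`.
    k<∣outer∣ : ∀ {k} → ∣ S ∣ + 2 * k < m → k < ∣ outer ∣
    k<∣outer∣ {k} small = ≰⇒> λ few → <⇒≱ small
      (≤-trans (≤-reflexive (sym (∣p∣+∣∁p∣≡n S)))
        (+-monoʳ-≤ ∣ S ∣ (≤-trans (p⊆q⇒∣p∣≤∣q∣ cover)
          (≤-trans (∣p∪q∣≤∣p∣+∣q∣ outer opposite)
            (+-mono-≤ few (≤-trans opposite≤ (≤-trans few (m≤m+n k 0))))))))
      where
      opposite = ∁ S ∩ ∁ leftSet
      cover : ∁ S ⊆ outer ∪ opposite
      cover {v} v∈ = x∈p∪q⁺ (case v ∈? leftSet of λ where
        (yes v∈L) → inj₁ (x∈p∩q⁺ (v∈ , v∈L))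
        (no v∉L)  → inj₂ (x∈p∩q⁺ (v∈ , x∉p⇒x∈∁p v∉L)))
      opposite≤ : ∣ opposite ∣ ≤ ∣ outer ∣
      opposite≤ = injection⇒∣p∣≤∣q∣ (μ M) opposite outer
        (λ {v} v∈ → let v∈∁S , v∉L = x∈p∩q⁻ (∁ S) (∁ leftSet) v∈ in
          x∈p∩q⁺ ( x∉p⇒x∈∁p (λ μv∈S → x∈∁p⇒x∉p v∈∁S (subst (_∈ S) (invol M v) (closed _ μv∈S)))
                 , ∈-leftSet⁺ (π-false M (Bool.¬-not (λ cv → x∈∁p⇒x∉p v∉L (∈-leftSet⁺ cv))))))
        (π-injective M)

    two-outside : ∣ S ∣ + 2 < m →
      ∃[ x ] ∃[ y ] ((x ∉ S × Left x) × (y ∉ S × Left y) × x ≢ y)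
    two-outside small =
      let x , y , x∈ , y∈ , x≢y = pick₂ outer (k<∣outer∣ small)
      in x , y , ∈-outer⁻ x∈ , ∈-outer⁻ y∈ , x≢y

    three-outside : ∣ S ∣ + 4 < m →
      ∃[ x ] ∃[ y ] ∃[ z ] ((x ∉ S × Left x) × (y ∉ S × Left y) × (z ∉ S × Left z) ×
                            x ≢ y × x ≢ z × y ≢ z)
    three-outside small =
      let x , y , z , x∈ , y∈ , z∈ , distinct = pick₃ outer (k<∣outer∣ small)
      in x , y , z , ∈-outer⁻ x∈ , ∈-outer⁻ y∈ , ∈-outer⁻ z∈ , distinct

-- Forcing number n - 2 in terms of arcs

2[n∸2]+4≡n+n : 2 ≤ n → 2 * (n ∸ 2) + 4 ≡ n + n
2[n∸2]+4≡n+n {n} 2≤n =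
  trans (sym (*-distribˡ-+ 2 (n ∸ 2) 2))
  (trans (cong (2 *_) (m∸n+n≡m 2≤n)) (cong (n +_) (+-identityʳ n)))

Lower : (n : ℕ) (G : Graph (n + n)) → Set
Lower n G = (M : PerfectMatching G) (S : Subset (n + n)) → IsForcingSet M S → 2 * (n ∸ 2) ≤ ∣ S ∣

module Balanced {n : ℕ} (2≤n : 2 ≤ n) (G : Graph (n + n)) (c : Fin (n + n) → Bool)
                (proper : ∀ u v → Edge G u v → c u ≢ c v) where
  open Coloured G c proper public
  open Matching using (Arc; arc?; π-injective; π-true; π-false) public

  -- The other edges of `M` would form a forcing set of n - 3 edges, one fewer than `Lower` allows.
  no-triangular-triple : Lower n G → (M : PerfectMatching G) → ∀ {x y z} →
    Left x → Left y → Left z → ¬ Arc M x y → ¬ Arc M x z → ¬ Arc M y z → ⊥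
  no-triangular-triple lower M {x} {y} {z} cx cy cz xy xz yz =
    let forcing , size = triangular⇒forcing M (x ∷ y ∷ z ∷ []) (cx ∷ cy ∷ cz ∷ [])
          ((xy ∷ xz ∷ []) ∷ (yz ∷ []) ∷ [] ∷ [])
    in <⇒≱ (+-monoʳ-< _ (s≤s (s≤s (s≤s (s≤s (s≤s z≤n))))))
         (≤-trans (≤-reflexive (trans size (sym (2[n∸2]+4≡n+n 2≤n)))) (+-monoˡ-≤ 4 (lower M _ forcing)))

  missing-arc⇒forcing : (M : PerfectMatching G) → ∀ {x y} → Left x → Left y → ¬ Arc M x y →
    Σ (Subset (n + n)) λ S → IsForcingSet M S × ∣ S ∣ ≡ 2 * (n ∸ 2)
  missing-arc⇒forcing M {x} {y} cx cy xy =
    let forcing , size = triangular⇒forcing M (x ∷ y ∷ []) (cx ∷ cy ∷ []) ((xy ∷ []) ∷ [] ∷ [])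
    in _ , forcing , +-cancelʳ-≡ 4 _ _ (trans size (sym (2[n∸2]+4≡n+n 2≤n)))

  -- Two uncovered edges with arcs in both directions would form a 2-cycle outside `S`.
  forcing⇒missing-arc : (M : PerfectMatching G) (S : Subset (n + n)) → IsForcingSet M S →
    ∣ S ∣ ≡ 2 * (n ∸ 2) → ∃[ x ] ∃[ y ] (Left x × Left y × ¬ Arc M x y)
  forcing⇒missing-arc M S forcing size = missing (two-outside M S forcing small)
    where
    missing : ∃[ x ] ∃[ y ] ((x ∉ S × Left x) × (y ∉ S × Left y) × x ≢ y) →
              ∃[ x ] ∃[ y ] (Left x × Left y × ¬ Arc M x y)
    missing (x , y , (x∉ , cx) , (y∉ , cy) , x≢y) = case arc? M x y of λ where
      (no ¬xy) → x , y , cx , cy , ¬xy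
      (yes xy) → y , x , cy , cx , forcing⇒no-2-cycle M S forcing x∉ y∉ cx cy x≢y xy
    small : ∣ S ∣ + 2 < n + n
    small = ≤-trans (+-monoʳ-< ∣ S ∣ (s≤s (s≤s (s≤s (z≤n {1})))))
              (≤-reflexive (trans (cong (_+ 4) size) (2[n∸2]+4≡n+n 2≤n)))

  -- A forcing set below the bound leaves three uncovered edges, so it is enough to refute three
  -- distinct left vertices outside a forcing set.
  lower-bound : ((M : PerfectMatching G) (S : Subset (n + n)) → IsForcingSet M S → ∀ {x y z} →
      x ∉ S × Left x → y ∉ S × Left y → z ∉ S × Left z → x ≢ y → x ≢ z → ¬ y ≢ z) →
    Lower n G
  lower-bound cyclic M S forcing = ≮⇒≥ λ small →
    let x , y , z , px , py , pz , x≢y , x≢z , y≢z = three-outside M S forcing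
          (≤-trans (+-monoˡ-≤ 4 small) (≤-reflexive (2[n∸2]+4≡n+n 2≤n)))
    in cyclic M S forcing px py pz x≢y x≢z y≢z

-- 𝒢₂ has forcing number n ∸ 2

module _ {Y V : Subset m} (E : Exchange (Y ∩ ∁ V) (Y ∩ V)) where
  open Exchange E

  exchange-across : ∀ {v} → v ∈ Y → to v ∈ Y × Across V v (to v)
  exchange-across {v} v∈Y = case v ∈? V of λ where
    (yes v∈V) → let t∈Y , t∈∁V = x∈p∩q⁻ Y (∁ V) (from∈ (x∈p∩q⁺ (v∈Y , v∈V)))
                in t∈Y , inj₁ (v∈V , x∈∁p⇒x∉p t∈∁V)
    (no v∉V)  → let t∈Y , t∈V = x∈p∩q⁻ Y V (to∈ (x∈p∩q⁺ (v∈Y , x∉p⇒x∈∁p v∉V)))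
                in t∈Y , inj₂ (v∉V , t∈V)

∩∁-disjoint : (Y V : Subset m) → ∀ {x} → x ∈ Y ∩ ∁ V → x ∉ Y ∩ V
∩∁-disjoint Y V x∈∁ x∈ = x∈∁p⇒x∉p (proj₂ (x∈p∩q⁻ Y (∁ V) x∈∁)) (proj₂ (x∈p∩q⁻ Y V x∈))

InG2⇒ForcingNumberIs : 2 ≤ n → (G : Graph (n + n)) → Bipartite G → InG2 n G →
  ForcingNumberIs G (n ∸ 2)
InG2⇒ForcingNumberIs {n} 2≤n G (c , proper)
  (a , b , 1≤a , 1≤b , _ , X , V , ∣XU∣ , ∣XV∣ , ∣X′U∣ , ∣X′V∣ , full , full′ , sided , sided′ , forb) =
  (M , upper) , lower-bound cyclic
  where
  open Balanced 2≤n G c proper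

  E₁ : Exchange (X ∩ ∁ V) (X ∩ V)
  E₁ = exchange _ _ (trans ∣XU∣ (sym ∣XV∣)) (∩∁-disjoint X V)
  E₂ : Exchange (∁ X ∩ ∁ V) (∁ X ∩ V)
  E₂ = exchange _ _ (trans ∣X′U∣ (sym ∣X′V∣)) (∩∁-disjoint (∁ X) V)
  module E₁ = Exchange E₁
  module E₂ = Exchange E₂

  partner : ∀ v → Dec (v ∈ X) → Fin (n + n)
  partner v (yes _) = E₁.to v
  partner v (no _)  = E₂.to v

  ν : Fin (n + n) → Fin (n + n)
  ν v = partner v (v ∈? X)

  ν-inside : ∀ {v} → v ∈ X → ν v ≡ E₁.to v
  ν-inside {v} v∈X with v ∈? X
  ... | yes _  = refl
  ... | no v∉X = contradiction v∈X v∉X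

  ν-outside : ∀ {v} → v ∉ X → ν v ≡ E₂.to v
  ν-outside {v} v∉X with v ∈? X
  ... | yes v∈X = contradiction v∈X v∉X
  ... | no _    = refl

  ν-edge : ∀ v → Edge G v (ν v)
  ν-edge v = case v ∈? X of λ where
    (yes v∈X) → let t∈X , across = exchange-across E₁ v∈X
                in subst (Edge G v) (sym (ν-inside v∈X)) (full _ _ v∈X t∈X across)
    (no v∉X)  → let t∈∁X , across = exchange-across E₂ (x∉p⇒x∈∁p v∉X)
                in subst (Edge G v) (sym (ν-outside v∉X))
                     (full′ _ _ v∉X (x∈∁p⇒x∉p t∈∁X) across)

  M : PerfectMatching G
  M = record
    { μ       = ν
    ; invol   = λ v → case v ∈? X of λ where
        (yes v∈X) → trans (cong ν (ν-inside v∈X))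
          (trans (ν-inside (proj₁ (exchange-across E₁ v∈X))) (E₁.invol′ v))
        (no v∉X) → trans (cong ν (ν-outside v∉X))
          (trans (ν-outside (x∈∁p⇒x∉p (proj₁ (exchange-across E₂ (x∉p⇒x∈∁p v∉X))))) (E₂.invol′ v))
    ; noFix   = λ v e → proper v v (subst (Edge G v) e (ν-edge v)) refl
    ; inGraph = ν-edge
    }

  -- The edges leaving `X` are forbidden, so no perfect matching uses one.
  preserves : (N : PerfectMatching G) → ∀ {v} → v ∈ X → μ N v ∈ X
  preserves N {v} v∈X = case μ N v ∈? X of λ where
    (yes ∈X) → ∈X
    (no ∉X)  → contradiction refl (forb v (μ N v) (inGraph N v) v∈X ∉X N)

  preserves′ : (N : PerfectMatching G) → ∀ {v} → v ∉ X → μ N v ∉ X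
  preserves′ N {v} v∉X μv∈X = v∉X (subst (_∈ X) (invol N v) (preserves N μv∈X))

  -- Instantiated with membership and with non-membership in `X`, so that one argument covers both
  -- complete halves.
  module _ {P : Fin (n + n) → Set}
           (fullP : ∀ u v → P u → P v → Across V u v → Edge G u v)
           (sidedP : ∀ u v → Edge G u v → P u → P v → Across V u v)
           (N : PerfectMatching G) (preservesP : ∀ {v} → P v → P (μ N v)) where

    -- The colouring `c` and the side set `V` need not agree, but within a half two vertices of
    -- equal colour lie on the same side of `V`: otherwise completeness would join them. Hence `x`
    -- is opposite to `μ N y`, just as `y` is.
    same-side⇒Arc : ∀ {x y} → Left x → Left y → P x → P y → Arc N x y
    same-side⇒Arc {x} {y} cx cy px py =
      by-cases (x ∈? V) (sidedP _ _ (inGraph N y) py (preservesP py))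
      where
      ¬across : ¬ Across V x y
      ¬across ac = proper _ _ (fullP _ _ px py ac) (trans cx (sym cy))
      by-cases : Dec (x ∈ V) → Across V y (μ N y) → Arc N x y
      by-cases (yes x∈V) (inj₁ (_ , μy∉V))  = fullP _ _ px (preservesP py) (inj₁ (x∈V , μy∉V))
      by-cases (yes x∈V) (inj₂ (y∉V , _))   = ⊥-elim (¬across (inj₁ (x∈V , y∉V)))
      by-cases (no x∉V)  (inj₁ (y∈V , _))   = ⊥-elim (¬across (inj₂ (x∉V , y∈V)))
      by-cases (no x∉V)  (inj₂ (_ , μy∈V))  = fullP _ _ px (preservesP py) (inj₂ (x∉V , μy∈V))

    left-element : ∀ {v} → P v → ∃[ u ] (Left u × P u)
    left-element {v} pv = case c v Bool.≟ false of λ where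
      (yes cv) → v , cv , pv
      (no cv)  → μ N v , π-false N (Bool.¬-not cv) , preservesP pv

  upper : Σ (Subset (n + n)) λ S → IsForcingSet M S × ∣ S ∣ ≡ 2 * (n ∸ 2)
  upper =
    let v , v∈ = 1≤∣p∣⇒Nonempty (X ∩ V) (≤-trans 1≤a (≤-reflexive (sym ∣XV∣)))
        w , w∈ = 1≤∣p∣⇒Nonempty (∁ X ∩ V) (≤-trans 1≤b (≤-reflexive (sym ∣X′V∣)))
    in from-elements (left-element full sided M (preserves M) (proj₁ (x∈p∩q⁻ X V v∈)))
         (left-element full′ sided′ M (preserves′ M) (x∈∁p⇒x∉p (proj₁ (x∈p∩q⁻ (∁ X) V w∈))))
    where
    from-elements : ∃[ x ] (Left x × x ∈ X) → ∃[ y ] (Left y × y ∉ X) →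
      Σ (Subset (n + n)) λ S → IsForcingSet M S × ∣ S ∣ ≡ 2 * (n ∸ 2)
    from-elements (x , cx , x∈X) (y , cy , y∉X) = case arc? M x y of λ where
      (no ¬xy) → missing-arc⇒forcing M cx cy ¬xy
      -- With arcs in both directions, switching would produce a matching through the forbidden edge
      -- from `x` to `μ M y`.
      (yes xy) → missing-arc⇒forcing M cy cx λ yx →
        let N , at-x , _ = rotate₂ M cx cy xy yx
        in forb _ _ xy x∈X (preserves′ M y∉X) N at-x

  -- Two of the three vertices lie in the same half, where arcs run both ways and form a 2-cycle
  -- outside `S`.
  cyclic : (N : PerfectMatching G) (S : Subset (n + n)) → IsForcingSet N S → ∀ {x y z} →
    x ∉ S × Left x → y ∉ S × Left y → z ∉ S × Left z → x ≢ y → x ≢ z → ¬ y ≢ z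
  cyclic N S forcing {x} {y} {z} (x∉ , cx) (y∉ , cy) (z∉ , cz) x≢y x≢z y≢z =
    pigeonhole (x ∈? X) (y ∈? X) (z ∈? X)
    where
    no-pair : ∀ {x y} → x ∉ S → y ∉ S → Left x → Left y → x ≢ y → (x ∈ X × y ∈ X) ⊎ (x ∉ X × y ∉ X) → ⊥
    no-pair x∉ y∉ cx cy x≢y (inj₁ (x∈X , y∈X)) =
      forcing⇒no-2-cycle N S forcing x∉ y∉ cx cy x≢y
        (same-side⇒Arc full sided N (preserves N) cx cy x∈X y∈X)
        (same-side⇒Arc full sided N (preserves N) cy cx y∈X x∈X)
    no-pair x∉ y∉ cx cy x≢y (inj₂ (x∉X , y∉X)) =
      forcing⇒no-2-cycle N S forcing x∉ y∉ cx cy x≢y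
        (same-side⇒Arc full′ sided′ N (preserves′ N) cx cy x∉X y∉X)
        (same-side⇒Arc full′ sided′ N (preserves′ N) cy cx y∉X x∉X)
    pigeonhole : Dec (x ∈ X) → Dec (y ∈ X) → Dec (z ∈ X) → ⊥
    pigeonhole (yes p) (yes q) _       = no-pair x∉ y∉ cx cy x≢y (inj₁ (p , q))
    pigeonhole (no p)  (no q)  _       = no-pair x∉ y∉ cx cy x≢y (inj₂ (p , q))
    pigeonhole (yes p) (no _)  (yes r) = no-pair x∉ z∉ cx cz x≢z (inj₁ (p , r))
    pigeonhole (no p)  (yes _) (no r)  = no-pair x∉ z∉ cx cz x≢z (inj₂ (p , r))
    pigeonhole (yes _) (no q)  (no r)  = no-pair y∉ z∉ cy cz y≢z (inj₂ (q , r))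
    pigeonhole (no _)  (yes q) (yes r) = no-pair y∉ z∉ cy cz y≢z (inj₁ (q , r))

-- Forcing number n ∸ 2 implies 𝒢₁ or 𝒢₂

lookup-injective : {A : Set} {xs : List A} → AllPairs _≢_ xs →
  ∀ i j → lookup xs i ≡ lookup xs j → i ≡ j
lookup-injective (x≢ ∷ _)    zero    zero    _  = refl
lookup-injective (x≢ ∷ _)    zero    (suc j) eq = contradiction eq (All.lookup x≢ (∈-lookup j))
lookup-injective (x≢ ∷ _)    (suc i) zero    eq = contradiction (sym eq) (All.lookup x≢ (∈-lookup i))
lookup-injective (_ ∷ uniq)  (suc i) (suc j) eq = cong suc (lookup-injective uniq i j eq)

-- Supplies the index set of the deleted bicliques: one index for each distinct nonempty row, so
-- that vertices with equal rows fall into one biclique.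
record DistinctValues {A : Set} (f : Fin m → A) (P : A → Set) : Set where
  field
    size      : ℕ
    value     : Fin size → A
    injective : ∀ i j → value i ≡ value j → i ≡ j
    attained  : ∀ i → ∃[ x ] (value i ≡ f x × P (f x))
    index     : ∀ x → P (f x) → ∃[ i ] value i ≡ f x

distinctValues : {A : Set} → DecidableEquality A → (f : Fin m → A) {P : A → Set} →
  Decidable P → DistinctValues f P
distinctValues {m} {A} _≟ᴬ_ f {P} P? = record
  { size      = length xs
  ; value     = lookup xs
  ; injective = lookup-injective (deduplicate-! _≟ᴬ_ ys)
  ; attained  = λ i →
      let y∈ , py      = ∈-filter⁻ P? {xs = map f (allFin m)} (∈-deduplicate⁻ _≟ᴬ_ ys (∈-lookup {xs = xs} i))
          x , _ , y≡fx = ∈-map⁻ f y∈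
      in x , y≡fx , subst P y≡fx py
  ; index     = λ x px →
      let fx∈ = ∈-deduplicate⁺ _≟ᴬ_ (∈-filter⁺ P? (∈-map⁺ f (∈-allFin x)) px)
      in Any.index fx∈ , sym (lookup-index fx∈)
  }
  where
  ys = filter P? (map f (allFin m))
  xs = deduplicate _≟ᴬ_ ys

m+m≡n+n⇒m≡n : ∀ m n → m + m ≡ n + n → m ≡ n
m+m≡n+n⇒m≡n m n eq = *-cancelˡ-≡ m n 2
  (trans (cong (m +_) (+-identityʳ m)) (trans eq (cong (n +_) (sym (+-identityʳ n)))))

module Structure {n : ℕ} (2≤n : 2 ≤ n) (G : Graph (n + n)) (c : Fin (n + n) → Bool)
                 (proper : ∀ u v → Edge G u v → c u ≢ c v)
                 (M : PerfectMatching G) (lower : Lower n G) where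
  open Balanced 2≤n G c proper

  V : Subset (n + n)
  V = ⟦ (λ v → c v Bool.≟ true) ⟧

  V⁺ : ∀ {v} → c v ≡ true → v ∈ V
  V⁺ = ∈-⟦⟧⁺ (λ v → c v Bool.≟ true)

  V⁻ : ∀ {v} → v ∈ V → c v ≡ true
  V⁻ = ∈-⟦⟧⁻ (λ v → c v Bool.≟ true)

  ∉V⁺ : ∀ {v} → Left v → v ∉ V
  ∉V⁺ cv v∈ = true≢false (V⁻ v∈) cv

  ∉V⁻ : ∀ {v} → v ∉ V → Left v
  ∉V⁻ v∉ = Bool.¬-not (v∉ ∘ V⁺)

  across : ∀ {u v} → Edge G u v → Across V u v
  across {u} {v} e with c u in cu | c v in cv
  ... | true  | true  = contradiction (trans cu (sym cv)) (proper u v e)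
  ... | true  | false = inj₁ (V⁺ cu , ∉V⁺ cv)
  ... | false | true  = inj₂ (∉V⁺ cu , V⁺ cv)
  ... | false | false = contradiction (trans cu (sym cv)) (proper u v e)

  ∣∁V∣≡∣V∣ : ∣ ∁ V ∣ ≡ ∣ V ∣
  ∣∁V∣≡∣V∣ = ≤-antisym
    (injection⇒∣p∣≤∣q∣ (μ M) (∁ V) V (λ v∈ → V⁺ (π-true M (∉V⁻ (x∈∁p⇒x∉p v∈)))) (π-injective M))
    (injection⇒∣p∣≤∣q∣ (μ M) V (∁ V) (λ v∈ → x∉p⇒x∈∁p (∉V⁺ (π-false M (V⁻ v∈)))) (π-injective M))

  ∣V∣≡n : ∣ V ∣ ≡ n
  ∣V∣≡n = m+m≡n+n⇒m≡n ∣ V ∣ n (trans (cong (∣ V ∣ +_) (sym ∣∁V∣≡∣V∣)) (∣p∣+∣∁p∣≡n V))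

  ∣∁V∣≡n : ∣ ∁ V ∣ ≡ n
  ∣∁V∣≡n = trans ∣∁V∣≡∣V∣ ∣V∣≡n

  -- u₁ – v₁ – u₂ – v₂ is an induced path of the bipartite complement.
  Obstruction : Fin (n + n) → Fin (n + n) → Fin (n + n) → Fin (n + n) → Set
  Obstruction u₁ u₂ v₁ v₂ =
    Left u₁ × Left u₂ × c v₁ ≡ true × c v₂ ≡ true ×
    Edge G u₁ v₂ × ¬ Edge G u₁ v₁ × ¬ Edge G u₂ v₁ × ¬ Edge G u₂ v₂

  obstruction? : Dec (∃[ u₁ ] ∃[ u₂ ] ∃[ v₁ ] ∃[ v₂ ] Obstruction u₁ u₂ v₁ v₂)
  obstruction? = any? λ u₁ → any? λ u₂ → any? λ v₁ → any? λ v₂ →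
    (c u₁ Bool.≟ false) ×-dec (c u₂ Bool.≟ false) ×-dec (c v₁ Bool.≟ true) ×-dec
    (c v₂ Bool.≟ true) ×-dec edge? u₁ v₂ ×-dec ¬? (edge? u₁ v₁) ×-dec
    ¬? (edge? u₂ v₁) ×-dec ¬? (edge? u₂ v₂)

  -- In a matching containing u₁v₂ the edges at u₂, u₁ and v₁, in this order, are triangular.
  obstruction⇒forbidden : ∀ {u₁ u₂ v₁ v₂} → Obstruction u₁ u₂ v₁ v₂ → Forbidden G u₁ v₂
  obstruction⇒forbidden {v₁ = v₁} (cu₁ , cu₂ , cv₁ , _ , _ , u₁v₁ , u₂v₁ , u₂v₂) N refl =
    no-triangular-triple lower N cu₂ cu₁ (π-false N cv₁)
      u₂v₂ (u₂v₁ ∘ subst (Edge G _) (invol N v₁)) (u₁v₁ ∘ subst (Edge G _) (invol N v₁))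

  -- Membership in 𝒢₂ from an obstruction

  module ForbiddenEdge {u₁ u₂ v₁ v₂} (obs : Obstruction u₁ u₂ v₁ v₂) where

    private
      -- The edge `u₁ v₂` of the obstruction becomes the arc from `i` to `j`; it lies in no perfect
      -- matching, so no directed cycle runs through it.
      i = u₁
      j = μ M v₂
      ci : Left i
      ci = proj₁ obs
      cj : Left j
      cj = π-false M (proj₁ (proj₂ (proj₂ (proj₂ obs))))
      ij : Arc M i j
      ij = subst (Edge G i) (sym (invol M v₂)) (proj₁ (proj₂ (proj₂ (proj₂ (proj₂ obs)))))
      not-exchanged : (N : PerfectMatching G) → μ N i ≢ μ M j
      not-exchanged N e = obstruction⇒forbidden obs N (trans e (invol M v₂))
      i≢j : i ≢ j
      i≢j i≡j = not-exchanged M (cong (μ M) i≡j)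

    -- The half `X` to be built consists of the `M`-edges with an arc into `i`; `i` belongs to it
    -- and `j` does not.
    InX : Fin (n + n) → Set
    InX k = Arc M k i

    ¬ji : ¬ Arc M j i
    ¬ji ji = let N , at-i , _ = rotate₂ M ci cj ij ji in not-exchanged N at-i

    i≢ : ∀ {k} → ¬ InX k → i ≢ k
    i≢ ¬ki refl = ¬ki (inGraph M i)

    j≢ : ∀ {k} → InX k → j ≢ k
    j≢ ki refl = ¬ji ki

    -- For `k` other than `i`, the vertices `i`, `j`, `k` would form a directed 3-cycle through the
    -- arc from `i` to `j`.
    InX⇒¬jk : ∀ {k} → Left k → InX k → ¬ Arc M j k
    InX⇒¬jk {k} ck ki jk = case i ≟ k of λ where
      (yes refl) → ¬ji jk
      (no i≢k)   → let N , at-i , _ = rotate₃ M ci cj ck i≢j i≢k (j≢ ki) ij jk ki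
                   in not-exchanged N at-i

    -- Without this arc, `j`, `k`, `i` would be a triangular triple.
    ¬InX⇒jk : ∀ {k} → Left k → ¬ InX k → Arc M j k
    ¬InX⇒jk {k} ck ¬ki = decidable-stable (arc? M j k) λ ¬jk →
      no-triangular-triple lower M cj ck ci ¬jk ¬ji ¬ki

    -- `j` has no arc to `x` or `y`, so a missing arc from `x` to `y` makes `j`, `x`, `y`
    -- triangular. In `complete′` the triple is `x`, `y`, `i`, since neither `x` nor `y` has an arc
    -- to `i`.
    complete : ∀ {x y} → Left x → Left y → InX x → InX y → Arc M x y
    complete {x} {y} cx cy xi yi = decidable-stable (arc? M x y) λ ¬xy →
      no-triangular-triple lower M cj cx cy (InX⇒¬jk cx xi) (InX⇒¬jk cy yi) ¬xy

    complete′ : ∀ {x y} → Left x → Left y → ¬ InX x → ¬ InX y → Arc M x y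
    complete′ {x} {y} cx cy ¬xi ¬yi = decidable-stable (arc? M x y) λ ¬xy →
      no-triangular-triple lower M cx cy ci ¬xy ¬xi ¬yi

    -- The 4-cycle `i`, `j`, `x`, `y` would pass through the arc from `i` to `j`; when `j` is `x` or
    -- `i` is `y`, the arc is already excluded.
    no-arc-back : ∀ {x y} → Left x → Left y → ¬ InX x → InX y → ¬ Arc M x y
    no-arc-back {x} {y} cx cy ¬xi yi xy = case (j ≟ x) of λ where
      (yes refl) → InX⇒¬jk cy yi xy
      (no j≢x) → case (i ≟ y) of λ where
        (yes refl) → ¬xi xy
        (no i≢y) → let N , at-i = rotate₄ M ci cj cx cy i≢j (i≢ ¬xi) i≢y j≢x (j≢ yi)
                                    (λ { refl → ¬xi yi }) ij (¬InX⇒jk cx ¬xi) xy yi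
                   in not-exchanged N at-i

    -- Names the `M`-edge at `v` by its left end, so that `X` below contains both ends of an edge or
    -- neither.
    leftEnd : Fin (n + n) → Fin (n + n)
    leftEnd v = if c v then μ M v else v

    leftEnd-left : ∀ {v} → Left v → leftEnd v ≡ v
    leftEnd-left cv rewrite cv = refl

    leftEnd-right : ∀ {v} → c v ≡ true → leftEnd v ≡ μ M v
    leftEnd-right cv rewrite cv = refl

    leftEnd-μ : ∀ v → leftEnd (μ M v) ≡ leftEnd v
    leftEnd-μ v = case c v Bool.≟ true of λ where
      (yes cv) → trans (leftEnd-left (π-false M cv)) (sym (leftEnd-right cv))
      (no cv)  → let cv′ = Bool.¬-not cv in
        trans (leftEnd-right (π-true M cv′)) (trans (invol M v) (sym (leftEnd-left cv′)))

    X? : Decidable (λ v → InX (leftEnd v))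
    X? v = arc? M (leftEnd v) i

    X : Subset (n + n)
    X = ⟦ X? ⟧

    X⁺ : ∀ {v} → InX (leftEnd v) → v ∈ X
    X⁺ = ∈-⟦⟧⁺ X?

    X⁻ : ∀ {v} → v ∈ X → InX (leftEnd v)
    X⁻ = ∈-⟦⟧⁻ X?

    μ∈X : ∀ {v} → v ∈ X → μ M v ∈ X
    μ∈X {v} v∈ = X⁺ (subst InX (sym (leftEnd-μ v)) (X⁻ v∈))

    μ∉X : ∀ {v} → v ∉ X → μ M v ∉ X
    μ∉X {v} v∉ μv∈ = v∉ (subst (_∈ X) (invol M v) (μ∈X μv∈))

    left-InX : ∀ {v} → Left v → v ∈ X → InX v
    left-InX cv v∈ = subst InX (leftEnd-left cv) (X⁻ v∈)

    left-¬InX : ∀ {v} → Left v → v ∉ X → ¬ InX v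
    left-¬InX cv v∉ vi = v∉ (X⁺ (subst InX (sym (leftEnd-left cv)) vi))

    Arc⇒Edge : ∀ {u v} → Arc M u (μ M v) → Edge G u v
    Arc⇒Edge {u} {v} = subst (Edge G u) (invol M v)

    Edge⇒Arc : ∀ {u v} → Edge G u v → Arc M u (μ M v)
    Edge⇒Arc {u} {v} = subst (Edge G u) (sym (invol M v))

    edge-X : ∀ {u v} → Left u → v ∈ V → u ∈ X → v ∈ X → Edge G u v
    edge-X cu v∈V u∈ v∈ = let cμv = π-false M (V⁻ v∈V) in
      Arc⇒Edge (complete cu cμv (left-InX cu u∈) (left-InX cμv (μ∈X v∈)))

    edge-∁X : ∀ {u v} → Left u → v ∈ V → u ∉ X → v ∉ X → Edge G u v
    edge-∁X cu v∈V u∉ v∉ = let cμv = π-false M (V⁻ v∈V) in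
      Arc⇒Edge (complete′ cu cμv (left-¬InX cu u∉) (left-¬InX cμv (μ∉X v∉)))

    no-edge-back : ∀ {u v} → Left u → c v ≡ true → u ∉ X → v ∈ X → ¬ Edge G u v
    no-edge-back cu cv u∉ v∈ e = let cμv = π-false M cv in
      no-arc-back cu cμv (left-¬InX cu u∉) (left-InX cμv (μ∈X v∈)) (Edge⇒Arc e)

    -- `M` pairs off an `M`-closed set between the colour classes; applied to `X` and `∁ X`, this
    -- gives the equal side sizes in 𝒢₂.
    module Halves (Y : Subset (n + n)) (μ∈Y : ∀ {v} → v ∈ Y → μ M v ∈ Y) where
      Y∩V⇒Y∩∁V : ∀ {v} → v ∈ Y ∩ V → μ M v ∈ Y ∩ ∁ V
      Y∩V⇒Y∩∁V v∈ = let v∈Y , v∈V = x∈p∩q⁻ Y V v∈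
                    in x∈p∩q⁺ (μ∈Y v∈Y , x∉p⇒x∈∁p (∉V⁺ (π-false M (V⁻ v∈V))))
      Y∩∁V⇒Y∩V : ∀ {v} → v ∈ Y ∩ ∁ V → μ M v ∈ Y ∩ V
      Y∩∁V⇒Y∩V v∈ = let v∈Y , v∈∁V = x∈p∩q⁻ Y (∁ V) v∈
                    in x∈p∩q⁺ (μ∈Y v∈Y , V⁺ (π-true M (∉V⁻ (x∈∁p⇒x∉p v∈∁V))))
      halves : ∣ Y ∩ V ∣ ≡ ∣ Y ∩ ∁ V ∣
      halves = ≤-antisym (injection⇒∣p∣≤∣q∣ (μ M) (Y ∩ V) (Y ∩ ∁ V) Y∩V⇒Y∩∁V (π-injective M))
                         (injection⇒∣p∣≤∣q∣ (μ M) (Y ∩ ∁ V) (Y ∩ V) Y∩∁V⇒Y∩V (π-injective M))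

    μ∈∁X : ∀ {v} → v ∈ ∁ X → μ M v ∈ ∁ X
    μ∈∁X v∈ = x∉p⇒x∈∁p (μ∉X (x∈∁p⇒x∉p v∈))

    -- A matching maps ∁ X ∩ ∁ V injectively into ∁ X ∩ V, so it has no edge from X ∩ ∁ V to ∁ X ∩ V.
    crossing-forbidden : ∀ {u v} → Edge G u v → u ∈ X → v ∉ X → Forbidden G u v
    crossing-forbidden {u} e u∈X v∉X N refl = case across e of λ where
      -- Here the left end lies outside `X` and the right end inside.
      (inj₁ (u∈V , v∉V)) → no-edge-back (∉V⁻ v∉V) (V⁻ u∈V) v∉X u∈X (edge-sym e)
      (inj₂ (_ , v∈V)) → <-irrefl (sym (Halves.halves (∁ X) μ∈∁X))
        (injection-missing⇒∣p∣<∣q∣ (μ N) (∁ X ∩ ∁ V) (∁ X ∩ V)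
          (λ {w} w∈ →
            let w∈∁X , w∈∁V = x∈p∩q⁻ (∁ X) (∁ V) w∈
                cw = ∉V⁻ (x∈∁p⇒x∉p w∈∁V)
                cNw = π-true N cw
            in x∈p∩q⁺ ( x∉p⇒x∈∁p (λ Nw∈X →
                          no-edge-back cw cNw (x∈∁p⇒x∉p w∈∁X) Nw∈X (inGraph N w))
                      , V⁺ cNw))
          (π-injective N)
          (x∈p∩q⁺ (x∉p⇒x∈∁p v∉X , v∈V))
          (λ w∈ Nw≡Nu → x∈∁p⇒x∉p (proj₁ (x∈p∩q⁻ (∁ X) (∁ V) w∈))
             (subst (_∈ X) (sym (π-injective N Nw≡Nu)) u∈X)))

    inG2 : InG2 n G
    inG2 =
      ∣ X ∩ ∁ V ∣ , ∣ ∁ X ∩ ∁ V ∣ ,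
      -- The halves are nonempty because of `i` and `j`: the matching edge at `i` is an arc from `i`
      -- to itself, and `j` has no arc to `i`.
      x∈p⇒1≤∣p∣ (x∈p∩q⁺ (X⁺ (subst InX (sym (leftEnd-left ci)) (inGraph M i)) , x∉p⇒x∈∁p (∉V⁺ ci))) ,
      x∈p⇒1≤∣p∣ (x∈p∩q⁺ (x∉p⇒x∈∁p (λ j∈X → ¬ji (left-InX cj j∈X)) , x∉p⇒x∈∁p (∉V⁺ cj))) ,
      trans (∣p∩q∣+∣∁p∩q∣≡∣q∣ X (∁ V)) ∣∁V∣≡n ,
      X , V , refl , Halves.halves X μ∈X , refl , Halves.halves (∁ X) μ∈∁X ,
      (λ u v u∈ v∈ → λ where
        (inj₁ (u∈V , v∉V)) → edge-sym (edge-X (∉V⁻ v∉V) u∈V v∈ u∈)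
        (inj₂ (u∉V , v∈V)) → edge-X (∉V⁻ u∉V) v∈V u∈ v∈) ,
      (λ u v u∉ v∉ → λ where
        (inj₁ (u∈V , v∉V)) → edge-sym (edge-∁X (∉V⁻ v∉V) u∈V v∉ u∉)
        (inj₂ (u∉V , v∈V)) → edge-∁X (∉V⁻ u∉V) v∈V u∉ v∉) ,
      (λ u v e _ _ → across e) ,
      (λ u v e _ _ → across e) ,
      (λ u v → crossing-forbidden)

  -- Membership in 𝒢₁ when no obstruction exists

  module NoObstruction
    (free : ∀ {u₁ u₂ v₁ v₂} → ¬ Obstruction u₁ u₂ v₁ v₂)
    {x y} (cx : Left x) (cy : Left y) (¬xy : ¬ Arc M x y) where

    Miss : Fin (n + n) → Fin (n + n) → Set
    Miss u v = Left u × c v ≡ true × ¬ Edge G u v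

    miss? : ∀ u → Decidable (Miss u)
    miss? u v = (c u Bool.≟ false) ×-dec (c v Bool.≟ true) ×-dec ¬? (edge? u v)

    -- The neighbourhood of `u` in the bipartite complement when `u` is a left vertex, and empty
    -- otherwise.
    row : Fin (n + n) → Subset (n + n)
    row u = ⟦ miss? u ⟧

    row⁺ : ∀ {u v} → Miss u v → v ∈ row u
    row⁺ {u} = ∈-⟦⟧⁺ (miss? u)

    row⁻ : ∀ {u v} → v ∈ row u → Miss u v
    row⁻ {u} = ∈-⟦⟧⁻ (miss? u)

    -- If `v` is in `row u` but `u′ v` is an edge, the path `u′`, `w`, `u`, `v` is an obstruction.
    -- Hence rows are equal or disjoint, and the complement splits into bicliques.
    meeting-rows-⊆ : ∀ {u u′ w} → w ∈ row u → w ∈ row u′ → row u ⊆ row u′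
    meeting-rows-⊆ {u} {u′} {w} w∈ w∈′ {v} v∈ =
      let cu , cw , ¬uw = row⁻ {u} w∈
          cu′ , _ , ¬u′w = row⁻ {u′} w∈′
          _ , cv , ¬uv = row⁻ {u} v∈
      in row⁺ {u′} (cu′ , cv , λ u′v → free (cu′ , cu , cw , cv , u′v , ¬u′w , ¬uw , ¬uv))

    meeting-rows-≡ : ∀ {u u′ w} → w ∈ row u → w ∈ row u′ → row u ≡ row u′
    meeting-rows-≡ {u} {u′} w∈ w∈′ =
      ⊆-antisym (meeting-rows-⊆ {u} {u′} w∈ w∈′) (meeting-rows-⊆ {u′} {u} w∈′ w∈)

    _≟ˢ_ : DecidableEquality (Subset (n + n))
    _≟ˢ_ = ≡-dec Bool._≟_

    rows : DistinctValues row Nonempty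
    rows = distinctValues _≟ˢ_ row nonempty?

    module R = DistinctValues rows

    A B : Fin R.size → Subset (n + n)
    A i = ⟦ (λ u → R.value i ≟ˢ row u) ⟧
    B i = R.value i

    A⁺ : ∀ {i u} → B i ≡ row u → u ∈ A i
    A⁺ {i} = ∈-⟦⟧⁺ (λ u → R.value i ≟ˢ row u)

    A⁻ : ∀ {i u} → u ∈ A i → B i ≡ row u
    A⁻ {i} = ∈-⟦⟧⁻ (λ u → R.value i ≟ˢ row u)

    miss-AB : ∀ {i u v} → u ∈ A i → v ∈ B i → Miss u v
    miss-AB {i} {u} {v} u∈ v∈ = row⁻ {u} (subst (v ∈_) (A⁻ u∈) v∈)

    A-nonempty : ∀ i → Nonempty (A i)
    A-nonempty i = let u , eq , _ = R.attained i in u , A⁺ eq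

    B-nonempty : ∀ i → Nonempty (B i)
    B-nonempty i = let u , eq , ne = R.attained i in subst Nonempty (sym eq) ne

    A⊆∁V : ∀ i → A i ⊆ ∁ V
    A⊆∁V i u∈ = x∉p⇒x∈∁p (∉V⁺ (proj₁ (miss-AB u∈ (proj₂ (B-nonempty i)))))

    B⊆V : ∀ i → B i ⊆ V
    B⊆V i v∈ = V⁺ (proj₁ (proj₂ (miss-AB (proj₂ (A-nonempty i)) v∈)))

    -- No edge joins `A i` to `B i`, so `μ M` carries `A i` injectively into the part of `V` outside
    -- `B i`.
    ∣A∣+∣B∣≤n : ∀ i → ∣ A i ∣ + ∣ B i ∣ ≤ n
    ∣A∣+∣B∣≤n i = ≤-trans (+-mono-≤ A≤ (p⊆q⇒∣p∣≤∣q∣ (λ v∈ → x∈p∩q⁺ (v∈ , B⊆V i v∈))))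
      (≤-reflexive (trans (+-comm ∣ ∁ (B i) ∩ V ∣ ∣ B i ∩ V ∣)
                   (trans (∣p∩q∣+∣∁p∩q∣≡∣q∣ (B i) V) ∣V∣≡n)))
      where
      A≤ : ∣ A i ∣ ≤ ∣ ∁ (B i) ∩ V ∣
      A≤ = injection⇒∣p∣≤∣q∣ (μ M) (A i) (∁ (B i) ∩ V)
        (λ {u} u∈ → x∈p∩q⁺
          ( x∉p⇒x∈∁p (λ μu∈ → proj₂ (proj₂ (miss-AB u∈ μu∈)) (inGraph M u))
          , V⁺ (π-true M (∉V⁻ (x∈∁p⇒x∉p (A⊆∁V i u∈))))))
        (π-injective M)

    A-disjoint : ∀ i j → i ≢ j → ∀ u → u ∈ A i → u ∉ A j
    A-disjoint i j i≢j u u∈i u∈j = i≢j (R.injective i j (trans (A⁻ u∈i) (sym (A⁻ u∈j))))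

    B-disjoint : ∀ i j → i ≢ j → ∀ v → v ∈ B i → v ∉ B j
    B-disjoint i j i≢j v v∈i v∈j =
      let u , eq , _   = R.attained i
          u′ , eq′ , _ = R.attained j
      in i≢j (R.injective i j (trans eq (trans
           (meeting-rows-≡ {u} {u′} (subst (v ∈_) eq v∈i) (subst (v ∈_) eq′ v∈j)) (sym eq′))))

    miss⇒AB : ∀ {u v} → Miss u v → ∃[ i ] (u ∈ A i × v ∈ B i)
    miss⇒AB {u} {v} miss = let i , eq = R.index u (v , row⁺ {u} miss)
                           in i , A⁺ eq , subst (v ∈_) (sym eq) (row⁺ {u} miss)

    Deleted : Fin (n + n) → Fin (n + n) → Set
    Deleted u v = ∃[ i ] ((u ∈ A i × v ∈ B i) ⊎ (v ∈ A i × u ∈ B i))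

    not-deleted⇒edge : ∀ {u v} → Across V u v → ¬ Deleted u v → Edge G u v
    not-deleted⇒edge {u} {v} (inj₁ (u∈V , v∉V)) ¬del = edge-sym (decidable-stable (edge? v u) λ ¬e →
      let i , v∈A , u∈B = miss⇒AB (∉V⁻ v∉V , V⁻ u∈V , ¬e) in ¬del (i , inj₂ (v∈A , u∈B)))
    not-deleted⇒edge {u} {v} (inj₂ (u∉V , v∈V)) ¬del = decidable-stable (edge? u v) λ ¬e →
      let i , u∈A , v∈B = miss⇒AB (∉V⁻ u∉V , V⁻ v∈V , ¬e) in ¬del (i , inj₁ (u∈A , v∈B))

    edge⇒not-deleted : ∀ {u v} → Edge G u v → ¬ Deleted u v
    edge⇒not-deleted e (i , inj₁ (u∈A , v∈B)) = proj₂ (proj₂ (miss-AB u∈A v∈B)) e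
    edge⇒not-deleted e (i , inj₂ (v∈A , u∈B)) = proj₂ (proj₂ (miss-AB v∈A u∈B)) (edge-sym e)

    1≤size : 1 ≤ R.size
    -- The missing arc from `x` to `y` is a missing edge from `x` to `μ M y`, and so lies in some
    -- biclique.
    1≤size = positive (proj₁ (miss⇒AB (cx , π-true M cy , ¬xy)))
      where
      positive : ∀ {t} → Fin t → 1 ≤ t
      positive zero    = s≤s z≤n
      positive (suc _) = s≤s z≤n

    inG1 : InG1 n G
    inG1 = V , ∣V∣≡n , ∣∁V∣≡n , R.size , 1≤size , A , B ,
      A⊆∁V , B⊆V , A-nonempty , B-nonempty , ∣A∣+∣B∣≤n , A-disjoint , B-disjoint ,
      λ u v → mk⇔ (λ e → across e , edge⇒not-deleted e)
                  (λ (ac , ¬del) → not-deleted⇒edge ac ¬del)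

ForcingNumberIs⇒InG1⊎InG2 : 2 ≤ n → (G : Graph (n + n)) → Bipartite G →
  ForcingNumberIs G (n ∸ 2) → InG1 n G ⊎ InG2 n G
ForcingNumberIs⇒InG1⊎InG2 2≤n G (c , proper) ((M , S , forcing , size) , lower) =
  case obstruction? of λ where
    (yes (_ , _ , _ , _ , obs)) → inj₂ (ForbiddenEdge.inG2 obs)
    (no ¬obs) →
      let _ , _ , cx , cy , ¬xy = forcing⇒missing-arc M S forcing size
      in inj₁ (NoObstruction.inG1 (λ obs → ¬obs (_ , _ , _ , _ , obs)) cx cy ¬xy)
  where
  open Balanced 2≤n G c proper
  open Structure 2≤n G c proper M lower

-- 𝒢₁ has forcing number n ∸ 2

InG1⇒ForcingNumberIs : 2 ≤ n → (G : Graph (n + n)) → InG1 n G → ForcingNumberIs G (n ∸ 2)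
InG1⇒ForcingNumberIs {n} 2≤n G
  (V , ∣V∣≡n , ∣∁V∣≡n , suc t , _ , A , B , A⊆∁V , B⊆V , A≢∅ , B≢∅ , ∣A∣+∣B∣≤n , A-disjoint , B-disjoint , edges) =
  (M , upper) , lower-bound cyclic
  where
  c : Fin (n + n) → Bool
  c = Vec.lookup V

  right⁺ : ∀ {v} → v ∈ V → c v ≡ true
  right⁺ = []=⇒lookup

  left⁺ : ∀ {v} → v ∉ V → c v ≡ false
  left⁺ {v} v∉ = Bool.¬-not (v∉ ∘ lookup⇒[]= v V)

  left⁻ : ∀ {v} → c v ≡ false → v ∉ V
  left⁻ cv v∈ = true≢false (right⁺ v∈) cv

  proper : ∀ u v → Edge G u v → c u ≢ c v
  proper u v e cu≡cv = case proj₁ (Equivalence.to (edges u v) e) of λ where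
    (inj₁ (u∈V , v∉V)) → true≢false (trans (sym cu≡cv) (right⁺ u∈V)) (left⁺ v∉V)
    (inj₂ (u∉V , v∈V)) → true≢false (right⁺ v∈V) (trans (sym cu≡cv) (left⁺ u∉V))

  open Balanced 2≤n G c proper

  deleted⇒¬edge : ∀ {i u v} → u ∈ A i → v ∈ B i → ¬ Edge G u v
  deleted⇒¬edge {i} u∈A v∈B e = proj₂ (Equivalence.to (edges _ _) e) (i , inj₁ (u∈A , v∈B))

  ¬edge⇒deleted : ∀ {u v} → Left u → c v ≡ true → ¬ Edge G u v → ∃[ i ] (u ∈ A i × v ∈ B i)
  ¬edge⇒deleted {u} {v} cu cv ¬e =
    decidable-stable (any? λ i → (u ∈? A i) ×-dec (v ∈? B i)) λ ¬del →
      ¬e (Equivalence.from (edges u v) (inj₂ (left⁻ cu , v∈V) , λ where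
        (i , inj₁ del)       → ¬del (i , del)
        (i , inj₂ (v∈A , _)) → x∈∁p⇒x∉p (A⊆∁V i v∈A) v∈V))
    where
    v∈V : v ∈ V
    v∈V = lookup⇒[]= v V cv

  A-index : ∀ {i k u} → u ∈ A i → u ∈ A k → i ≡ k
  A-index {i} {k} {u} u∈i u∈k = decidable-stable (i ≟ k) λ i≢k → A-disjoint i k i≢k u u∈i u∈k

  B-index : ∀ {i k v} → v ∈ B i → v ∈ B k → i ≡ k
  B-index {i} {k} {v} v∈i v∈k = decidable-stable (i ≟ k) λ i≢k → B-disjoint i k i≢k v v∈i v∈k

  initial : Pairing c
  initial = record
    { π     = E.to
    ; π-π   = E.invol′
    ; flips = λ v → case v ∈? V of λ where
        (yes v∈V) → trans (left⁺ (x∈∁p⇒x∉p (E.from∈ v∈V))) (cong not (sym (right⁺ v∈V)))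
        (no v∉V)  → trans (right⁺ (E.to∈ (x∉p⇒x∈∁p v∉V))) (cong not (sym (left⁺ v∉V)))
    }
    where
    sides : Exchange (∁ V) V
    sides = exchange (∁ V) V (trans ∣∁V∣≡n (sym ∣V∣≡n)) x∈∁p⇒x∉p
    module E = Exchange sides

  -- The pair at x is counted by both A i and B i, so these cannot meet all n pairs.
  avoiding-pair : (P : Pairing c) → ∀ {i x} → x ∈ A i → Pairing.π P x ∈ B i →
    ∃[ u ] (Left u × u ∉ A i × Pairing.π P u ∉ B i)
  avoiding-pair P {i} {x} x∈A πx∈B =
    decidable-stable (any? λ u → (c u Bool.≟ false) ×-dec ¬? (u ∈? A i) ×-dec ¬? (π u ∈? B i)) λ none →
      let cover : ∁ V ⊆ A i ∪ (B′ - x)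
          cover {u} u∈ = x∈p∪q⁺ (case u ∈? A i of λ where
            (yes u∈A) → inj₁ u∈A
            (no u∉A)  → inj₂ (x∈p∧x≢y⇒x∈p-y
              (∈-⟦⟧⁺ πB? (decidable-stable (πB? u) λ πu∉B →
                none (u , left⁺ (x∈∁p⇒x∉p u∈) , u∉A , πu∉B)))
              (λ { refl → u∉A x∈A })))
      in <⇒≱ (+-monoʳ-< ∣ A i ∣ (≤-trans (x∈p⇒∣p-x∣<∣p∣ (∈-⟦⟧⁺ πB? πx∈B)) B′≤B))
           (≤-trans (∣A∣+∣B∣≤n i) (≤-trans (≤-reflexive (sym ∣∁V∣≡n))
             (≤-trans (p⊆q⇒∣p∣≤∣q∣ cover) (∣p∪q∣≤∣p∣+∣q∣ (A i) (B′ - x)))))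
    where
    open Pairing P using (π)
    πB? : Decidable (λ u → π u ∈ B i)
    πB? u = π u ∈? B i
    B′ : Subset (n + n)
    B′ = ⟦ πB? ⟧
    B′≤B : ∣ B′ ∣ ≤ ∣ B i ∣
    B′≤B = injection⇒∣p∣≤∣q∣ π B′ (B i) (∈-⟦⟧⁻ πB?) (Pairing.π-injective P)

  Repaired : List (Fin (n + n)) → Set
  Repaired L = Σ (Pairing c) λ P → ∀ {u} → u ∈ˡ L → Left u → Edge G u (Pairing.π P u)

  -- Exchanging partners with a pair that avoids A i and B i makes both pairs edges of G.
  repair : ∀ L → Repaired L
  repair []      = initial , λ ()
  repair (x ∷ L) = step (repair L)
    where
    step : Repaired L → Repaired (x ∷ L)
    step (P , good) = case edge? x (π x) of λ where
        (yes e) → P , λ { (here refl) _ → e ; (there u∈L) cu → good u∈L cu }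
        (no ¬e) → case c x Bool.≟ false of λ where
          (no cx) → P , λ { (here refl) cu → contradiction cu cx ; (there u∈L) cu → good u∈L cu }
          (yes cx) →
            let i , x∈A , πx∈B = ¬edge⇒deleted cx (partner-right cx) ¬e
            in exchange-at cx x∈A πx∈B (avoiding-pair P x∈A πx∈B)
      where
      open Pairing P using (π) renaming (π-true to partner-right)
      exchange-at : Left x → ∀ {i} → x ∈ A i → π x ∈ B i →
        ∃[ u ] (Left u × u ∉ A i × π u ∉ B i) → Repaired (x ∷ L)
      exchange-at cx {i} x∈A πx∈B (u , cu , u∉A , πu∉B) = swap , good′
        where
        open Swap P cx cu
        -- By disjointness only biclique `i` can contain `x` or `π x`, and `u` avoids `A i` while
        -- `π u` avoids `B i`.
        edge-x : Edge G x (π u)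
        edge-x = decidable-stable (edge? x (π u)) λ ¬e →
          let k , x∈Ak , πu∈Bk = ¬edge⇒deleted cx (partner-right cu) ¬e
          in πu∉B (subst (λ l → π u ∈ B l) (A-index x∈Ak x∈A) πu∈Bk)
        edge-u : Edge G u (π x)
        edge-u = decidable-stable (edge? u (π x)) λ ¬e →
          let k , u∈Ak , πx∈Bk = ¬edge⇒deleted cu (partner-right cx) ¬e
          in u∉A (subst (λ l → u ∈ A l) (B-index πx∈Bk πx∈B) u∈Ak)
        good′ : ∀ {w} → w ∈ˡ x ∷ L → Left w → Edge G w (Pairing.π swap w)
        good′ {w} w∈ cw = case (w ≟ x) of λ where
          (yes refl) → subst (Edge G w) (sym swap-left) edge-x
          (no w≢x) → case (w ≟ u) of λ where
            (yes refl) → subst (Edge G w) (sym swap-right) edge-u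
            (no w≢u) → subst (Edge G w) (sym (swap-other cw w≢x w≢u)) (case w∈ of λ where
              (here w≡x)  → contradiction w≡x w≢x
              (there w∈L) → good w∈L cw)

  M : PerfectMatching G
  M = let P , good = repair (allFin (n + n)) in fromPairing P (good (∈-allFin _))

  upper : Σ (Subset (n + n)) λ S → IsForcingSet M S × ∣ S ∣ ≡ 2 * (n ∸ 2)
  upper =
    -- The first biclique exists because their number is positive; a pair deleted there gives the
    -- missing arc from `x` to `μ M v`.
    let x , x∈A = A≢∅ zero
        v , v∈B = B≢∅ zero
    in missing-arc⇒forcing M (left⁺ (x∈∁p⇒x∉p (A⊆∁V zero x∈A))) (π-false M (right⁺ (B⊆V zero v∈B)))
         (deleted⇒¬edge x∈A v∈B ∘ subst (Edge G x) (invol M v))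

  -- If all three arcs were missing, disjointness would put the three missing edges into one
  -- biclique, with `y` in its `A` part and `μ N y` in its `B` part; but these two are matched.
  missing-not-transitive : (N : PerfectMatching G) → ∀ {x y z} → Left x → Left y → Left z →
    ¬ Arc N x y → ¬ Arc N y z → Arc N x z
  missing-not-transitive N {x} {y} {z} cx cy cz ¬xy ¬yz = decidable-stable (arc? N x z) λ ¬xz →
    let i , x∈Ai , y∈Bi = ¬edge⇒deleted cx (π-true N cy) ¬xy
        j , y∈Aj , z∈Bj = ¬edge⇒deleted cy (π-true N cz) ¬yz
        k , x∈Ak , z∈Bk = ¬edge⇒deleted cx (π-true N cz) ¬xz
        i≡j = trans (A-index x∈Ai x∈Ak) (B-index z∈Bk z∈Bj)
    in deleted⇒¬edge y∈Aj (subst (λ l → μ N y ∈ B l) i≡j y∈Bi) (inGraph N y)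

  cyclic : (N : PerfectMatching G) (S : Subset (n + n)) → IsForcingSet N S → ∀ {x y z} →
    x ∉ S × Left x → y ∉ S × Left y → z ∉ S × Left z → x ≢ y → x ≢ z → ¬ y ≢ z
  cyclic N S forcing {x} {y} {z} px py pz x≢y x≢z y≢z =
    no-2-cycle px py x≢y (arc-between px py pz x≢y x≢z y≢z)
      (arc-between py px pz (≢-sym x≢y) y≢z x≢z)
    where
    no-2-cycle : ∀ {x y} → x ∉ S × Left x → y ∉ S × Left y → x ≢ y → Arc N x y → ¬ Arc N y x
    no-2-cycle (x∉ , cx) (y∉ , cy) = forcing⇒no-2-cycle N S forcing x∉ y∉ cx cy
    -- Suppose the arc from `x` to `y` is missing. Then `missing-not-transitive` and the absence of
    -- 2-cycles determine the other arcs: without an arc from `y` to `z` there is a 3-cycle `x`,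
    -- `z`, `y` outside `S`, and with one the arc from `x` to `y` is present after all.
    arc-between : ∀ {x y z} → x ∉ S × Left x → y ∉ S × Left y → z ∉ S × Left z →
      x ≢ y → x ≢ z → y ≢ z → Arc N x y
    arc-between {x} {y} {z} px@(x∉ , cx) py@(y∉ , cy) pz@(z∉ , cz) x≢y x≢z y≢z =
      decidable-stable (arc? N x y) λ ¬xy → case arc? N y z of λ where
        (no ¬yz) →
          let xz  = missing-not-transitive N cx cy cz ¬xy ¬yz
              ¬zx = no-2-cycle px pz x≢z xz
              zy  = missing-not-transitive N cz cx cy ¬zx ¬xy
              yx  = missing-not-transitive N cy cz cx ¬yz ¬zx
          in forcing⇒no-3-cycle N S forcing x∉ z∉ y∉ cx cz cy x≢z x≢y (≢-sym y≢z) xz zy yx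
        (yes yz) →
          let ¬zy = no-2-cycle py pz y≢z yz
              zx  = decidable-stable (arc? N z x) λ ¬zx →
                      ¬zy (missing-not-transitive N cz cx cy ¬zx ¬xy)
              ¬xz = λ xz → no-2-cycle px pz x≢z xz zx
          in ¬xy (missing-not-transitive N cx cz cy ¬xz ¬zy)

theorem4p6 : (n : ℕ) → 2 ≤ n → (G : Graph (n + n)) → Bipartite G →
    ForcingNumberIs G (n ∸ 2) ⇔ (InG1 n G ⊎ InG2 n G)
theorem4p6 n 2≤n G bip = mk⇔ (ForcingNumberIs⇒InG1⊎InG2 2≤n G bip)
  [ InG1⇒ForcingNumberIs 2≤n G , InG2⇒ForcingNumberIs 2≤n G bip ]′
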